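{- Let $\tau$ be a relational vocabulary. Then every satisfiable $\varphi\in\tau\text{ - }\mathsf{FO}^2(\sim)$ has a model of size $\exp_{O(|\varphi|)}(1)$. That is, there is a constant $c$ such that for every satisfiable $\varphi\in\tau\text{ - }\mathsf{FO}^2(\sim)$ there are a $\tau$-structure $\mathcal B$ with $|\mathrm{dom}\,\mathcal B|\le\exp_{c\cdot|\varphi|}(1)$ and a team $T$ in $\mathcal B$ whose domain contains the free variables of $\varphi$ such that $(\mathcal B,T)\vDash\varphi$.
   Context: $\exp_0(n)=n$, $\exp_{k+1}(n)=2^{\exp_k(n)}$; $|\varphi|$ is the length of $\varphi$ in a suitable encoding. A vocabulary is a (possibly infinite) set of function and predicate symbols containing at least one predicate or equality (equality may be used only if ${=}\in\tau$); it is relational if it contains no function symbols. $\tau\text{ - }\mathsf{FO}(\sim)$ has the formulas $\varphi ::= \alpha \mid {\sim}\varphi \mid \varphi\wedge\varphi \mid \varphi\vee\varphi \mid \exists x\,\varphi \mid \forall x\,\varphi$ with $\alpha$ an ordinary first-order $\tau$-formula; $\tau\text{ - }\mathsf{FO}^2(\sim)$ consists of those formulas in which at most two distinct variables occur (free or bound). A team $T$ in a structure $\mathcal A$ with domain $X$ (a set of variables) is a set of assignments $s\colon X\to\mathrm{dom}\,\mathcal A$. For $f\colon T\to\mathfrak P(\mathrm{dom}\,\mathcal A)\setminus\{\emptyset\}$ let $T^x_f=\{s^x_a\mid s\in T, a\in f(s)\}$, where $s^x_a$ maps $x$ to $a$ and agrees with $s$ on the other variables; $T^x_A$ is the case $f(s)=A$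 constant. For a team whose domain contains the free variables of $\varphi$: if $\varphi\in\mathsf{FO}$, $(\mathcal A,T)\vDash\varphi$ iff $(\mathcal A,s)\vDash\varphi$ (Tarski) for all $s\in T$; otherwise $(\mathcal A,T)\vDash{\sim}\psi$ iff $(\mathcal A,T)\nvDash\psi$; $\wedge$ is conjunction; $(\mathcal A,T)\vDash\psi\vee\theta$ iff there are $S,U\subseteq T$ with $T=S\cup U$, $(\mathcal A,S)\vDash\psi$, $(\mathcal A,U)\vDash\theta$; $(\mathcal A,T)\vDash\exists x\,\psi$ iff $(\mathcal A,T^x_f)\vDash\psi$ for some such $f$; $(\mathcal A,T)\vDash\forall x\,\psi$ iff $(\mathcal A,T^x_{\mathrm{dom}\,\mathcal A})\vDash\psi$. $\varphi$ is satisfiable if $(\mathcal A,T)\vDash\varphi$ for some $\tau$-structure $\mathcal A$ and team $T$ in $\mathcal A$ whose domain contains the free variables of $\varphi$. -}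

module Defs where

open import Data.Bool.Base using (Bool; T)
open import Data.Fin.Base using (Fin)
open import Data.List.Base using (List; []; _∷_; _++_)
import Data.List.Membership.Propositional as List
import Data.List.Relation.Binary.Subset.Propositional as List
open import Data.List.Membership.Propositional.Properties using (∈-++⁺ˡ; ∈-++⁺ʳ)
open import Data.List.Relation.Unary.Any using (here)
open import Data.Nat.Base using (ℕ; zero; suc; _+_; _^_; _≤_)
open import Data.Nat.Properties using (_≟_)
open import Data.Product.Base using (Σ-syntax; ∃-syntax; _×_; _,_)
open import Data.Sum.Base using (_⊎_; inj₁; inj₂)
open import Data.Unit.Base using (tt)
open import Data.Vec.Base using (Vec; []; _∷_)
open import Function.Base using (_∘_)
open import Function.Bundles using (_↔_)
open import Level using (0ℓ; Lift) renaming (suc to lsuc)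
open import Relation.Binary.Core using (Rel)
open import Relation.Binary.Definitions using (_Respects_)
open import Relation.Binary.PropositionalEquality using (_≡_; refl; sym; trans)
open import Relation.Nullary using (¬_; yes; no; contradiction)
open import Relation.Unary using (Pred; U; _∈_; _⊆_; _≐_; _∪_; _∖_; ｛_｝; Satisfiable)

exp : ℕ → ℕ → ℕ
exp zero    n = n
exp (suc k) n = 2 ^ exp k n

record Vocabulary : Set₁ where
  field
    FunSym    : Set
    funArity  : FunSym → ℕ
    PredSym   : Set
    predArity : PredSym → ℕ
    hasEq     : Bool
    nontrivial : PredSym ⊎ T hasEq

open Vocabulary public

Relational : Vocabulary → Set
Relational τ = ¬ FunSym τ

Var : Set
Var = ℕ

data Term (τ : Vocabulary) : Set where
  var : Var → Term τ
  fun : (f : FunSym τ) → Vec (Term τ) (funArity τ f) → Term τ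

infix  9 ¬̇_ ∼_
infix  8 ∃̇⟨_⟩_ ∀̇⟨_⟩_ ∃⟨_⟩_ ∀⟨_⟩_
infixr 7 _∧̇_ _∧_
infixr 6 _∨̇_ _∨_

data FO (τ : Vocabulary) : Set where
  pred   : (R : PredSym τ) → Vec (Term τ) (predArity τ R) → FO τ
  equal  : T (hasEq τ) → Term τ → Term τ → FO τ
  ¬̇_     : FO τ → FO τ
  _∧̇_    : FO τ → FO τ → FO τ
  _∨̇_    : FO τ → FO τ → FO τ
  ∃̇⟨_⟩_  : Var → FO τ → FO τ
  ∀̇⟨_⟩_  : Var → FO τ → FO τ

-- A first-order formula such as α ∧ β has several representations here,
-- fo (α ∧̇ β) and fo α ∧ fo β.  They have the same length, and the team
-- clauses for ∧, ∨, ∃, ∀ agree with the flat clause on first-order formulas.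
data FO∼ (τ : Vocabulary) : Set where
  fo    : FO τ → FO∼ τ
  ∼_    : FO∼ τ → FO∼ τ
  _∧_   : FO∼ τ → FO∼ τ → FO∼ τ
  _∨_   : FO∼ τ → FO∼ τ → FO∼ τ
  ∃⟨_⟩_ : Var → FO∼ τ → FO∼ τ
  ∀⟨_⟩_ : Var → FO∼ τ → FO∼ τ

module _ {τ : Vocabulary} where

  -- Lengths count every occurrence of a symbol (connective, quantifier,
  -- variable, non-logical symbol) as 1, brackets and commas as 0.

  termLength  : Term τ → ℕ
  termsLength : ∀ {n} → Vec (Term τ) n → ℕ

  termLength (var x)    = 1
  termLength (fun f ts) = 1 + termsLength ts

  termsLength []       = 0
  termsLength (t ∷ ts) = termLength t + termsLength ts

  foLength : FO τ → ℕ
  foLength (pred R ts)   = 1 + termsLength ts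
  foLength (equal _ t u) = 1 + termLength t + termLength u
  foLength (¬̇ α)         = 1 + foLength α
  foLength (α ∧̇ β)       = 1 + foLength α + foLength β
  foLength (α ∨̇ β)       = 1 + foLength α + foLength β
  foLength (∃̇⟨ x ⟩ α)    = 2 + foLength α
  foLength (∀̇⟨ x ⟩ α)    = 2 + foLength α

  ∣_∣ : FO∼ τ → ℕ
  ∣ fo α ∣     = foLength α
  ∣ ∼ φ ∣      = 1 + ∣ φ ∣
  ∣ φ ∧ ψ ∣    = 1 + ∣ φ ∣ + ∣ ψ ∣
  ∣ φ ∨ ψ ∣    = 1 + ∣ φ ∣ + ∣ ψ ∣
  ∣ ∃⟨ x ⟩ φ ∣ = 2 + ∣ φ ∣
  ∣ ∀⟨ x ⟩ φ ∣ = 2 + ∣ φ ∣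

  termVars  : Term τ → List Var
  termsVars : ∀ {n} → Vec (Term τ) n → List Var

  termVars (var x)    = x ∷ []
  termVars (fun f ts) = termsVars ts

  termsVars []       = []
  termsVars (t ∷ ts) = termVars t ++ termsVars ts

  foVars : FO τ → List Var
  foVars (pred R ts)   = termsVars ts
  foVars (equal _ t u) = termVars t ++ termVars u
  foVars (¬̇ α)         = foVars α
  foVars (α ∧̇ β)       = foVars α ++ foVars β
  foVars (α ∨̇ β)       = foVars α ++ foVars β
  foVars (∃̇⟨ x ⟩ α)    = x ∷ foVars α
  foVars (∀̇⟨ x ⟩ α)    = x ∷ foVars α

  vars : FO∼ τ → List Var
  vars (fo α)     = foVars α
  vars (∼ φ)      = vars φ
  vars (φ ∧ ψ)    = vars φ ++ vars ψ
  vars (φ ∨ ψ)    = vars φ ++ vars ψ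
  vars (∃⟨ x ⟩ φ) = x ∷ vars φ
  vars (∀⟨ x ⟩ φ) = x ∷ vars φ

  TwoVariable : FO∼ τ → Set
  TwoVariable φ = ∃[ x ] ∃[ y ] vars φ List.⊆ x ∷ y ∷ []

  foFree : FO τ → Pred Var 0ℓ
  foFree (pred R ts)   = List._∈ termsVars ts
  foFree (equal _ t u) = List._∈ (termVars t ++ termVars u)
  foFree (¬̇ α)         = foFree α
  foFree (α ∧̇ β)       = foFree α ∪ foFree β
  foFree (α ∨̇ β)       = foFree α ∪ foFree β
  foFree (∃̇⟨ x ⟩ α)    = foFree α ∖ ｛ x ｝
  foFree (∀̇⟨ x ⟩ α)    = foFree α ∖ ｛ x ｝

  Free : FO∼ τ → Pred Var 0ℓ
  Free (fo α)     = foFree α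
  Free (∼ φ)      = Free φ
  Free (φ ∧ ψ)    = Free φ ∪ Free ψ
  Free (φ ∨ ψ)    = Free φ ∪ Free ψ
  Free (∃⟨ x ⟩ φ) = Free φ ∖ ｛ x ｝
  Free (∀⟨ x ⟩ φ) = Free φ ∖ ｛ x ｝

record Structure (τ : Vocabulary) : Set₁ where
  field
    dom     : Set
    point   : dom          -- domains are nonempty
    ⟦_⟧fun  : (f : FunSym τ) → Vec dom (funArity τ f) → dom
    ⟦_⟧pred : (R : PredSym τ) → Pred (Vec dom (predArity τ R)) 0ℓ

open Structure public

SizeAtMost : ∀ {τ} → ℕ → Structure τ → Set
SizeAtMost N 𝒜 = ∃[ n ] n ≤ N × (dom 𝒜 ↔ Fin n)

-- A function X → A for a set X of variables; irrelevance makes the value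
-- independent of the proof of membership.
Assignment : Pred Var 0ℓ → Set → Set
Assignment X A = (v : Var) → .(v ∈ X) → A

Pointwise : (X : Pred Var 0ℓ) (A : Set) → Rel (Assignment X A) 0ℓ
Pointwise X A s t = ∀ v .(v∈X : v ∈ X) → s v v∈X ≡ t v v∈X

∪-drop : ∀ {X : Pred Var 0ℓ} {x v} → ¬ x ≡ v → v ∈ X ∪ ｛ x ｝ → v ∈ X
∪-drop x≢v (inj₁ v∈X) = v∈X
∪-drop x≢v (inj₂ x≡v) = contradiction x≡v x≢v

_[_↦_] : ∀ {X A} → Assignment X A → (x : Var) → A → Assignment (X ∪ ｛ x ｝) A
_[_↦_] {X} s x a v v∈ with x ≟ v
... | yes _   = a
... | no  x≢v = s v (∪-drop {X} x≢v v∈)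

-- Functions are not extensional in Agda, so sets of assignments, and maps
-- defined on them, are required to respect pointwise equality.
record Team (X : Pred Var 0ℓ) (A : Set) : Set₁ where
  field
    member      : Pred (Assignment X A) 0ℓ
    member-resp : member Respects Pointwise X A

open Team public

-- A map f : T → 𝔓(A) ∖ {∅}; the values outside T are never used.
record Choice {X A} (𝒯 : Team X A) : Set₁ where
  field
    values      : Assignment X A → Pred A 0ℓ
    values-resp : ∀ {s t} → Pointwise X A s t → values s ⊆ values t
    nonempty    : ∀ {s} → s ∈ member 𝒯 → Satisfiable (values s)

open Choice public

supplement : ∀ {X A} (𝒯 : Team X A) (x : Var) → Choice 𝒯 → Team (X ∪ ｛ x ｝) A
supplement {X} {A} 𝒯 x f .member t =
  ∃[ s ] ∃[ a ] s ∈ member 𝒯 × a ∈ values f s ×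
    Pointwise (X ∪ ｛ x ｝) A t (s [ x ↦ a ])
supplement 𝒯 x f .member-resp t≗u (s , a , s∈ , a∈ , t≗) =
  s , a , s∈ , a∈ , λ v v∈ → trans (sym (t≗u v v∈)) (t≗ v v∈)

everything : ∀ {X A} (𝒯 : Team X A) → A → Choice 𝒯
everything 𝒯 a .values _          = U
everything 𝒯 a .values-resp _ b∈U = b∈U
everything 𝒯 a .nonempty _        = a , tt

bind : ∀ {F X : Pred Var 0ℓ} {x} → F ∖ ｛ x ｝ ⊆ X → F ⊆ X ∪ ｛ x ｝
bind {x = x} F∖x⊆X {v} v∈F with x ≟ v
... | yes x≡v = inj₂ x≡v
... | no  x≢v = inj₁ (F∖x⊆X (v∈F , x≢v))

module _ {τ : Vocabulary} (𝒜 : Structure τ) where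

  eval  : ∀ {X} → Assignment X (dom 𝒜) →
          (t : Term τ) → .((List._∈ termVars t) ⊆ X) → dom 𝒜
  evals : ∀ {X n} → Assignment X (dom 𝒜) →
          (ts : Vec (Term τ) n) → .((List._∈ termsVars ts) ⊆ X) → Vec (dom 𝒜) n

  eval s (var x)    h = s x (h (here refl))
  eval s (fun f ts) h = ⟦_⟧fun 𝒜 f (evals s ts h)

  evals s []       h = []
  evals s (t ∷ ts) h = eval s t (h ∘ ∈-++⁺ˡ) ∷ evals s ts (h ∘ ∈-++⁺ʳ (termVars t))

  Tarski : ∀ {X} → Assignment X (dom 𝒜) → (α : FO τ) → .(foFree α ⊆ X) → Set
  Tarski s (pred R ts)   h = evals s ts h ∈ ⟦_⟧pred 𝒜 R
  Tarski s (equal _ t u) h = eval s t (h ∘ ∈-++⁺ˡ) ≡ eval s u (h ∘ ∈-++⁺ʳ (termVars t))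
  Tarski s (¬̇ α)         h = ¬ Tarski s α h
  Tarski s (α ∧̇ β)       h = Tarski s α (h ∘ inj₁) × Tarski s β (h ∘ inj₂)
  Tarski s (α ∨̇ β)       h = Tarski s α (h ∘ inj₁) ⊎ Tarski s β (h ∘ inj₂)
  Tarski s (∃̇⟨ x ⟩ α)    h = ∃[ a ] Tarski (s [ x ↦ a ]) α (bind h)
  Tarski s (∀̇⟨ x ⟩ α)    h = ∀ a → Tarski (s [ x ↦ a ]) α (bind h)

  Sat : ∀ {X} → Team X (dom 𝒜) → (φ : FO∼ τ) → .(Free φ ⊆ X) → Set₁
  Sat 𝒯 (fo α)     h = Lift (lsuc 0ℓ) (∀ s → s ∈ member 𝒯 → Tarski s α h)
  Sat 𝒯 (∼ φ)      h = ¬ Sat 𝒯 φ h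
  Sat 𝒯 (φ ∧ ψ)    h = Sat 𝒯 φ (h ∘ inj₁) × Sat 𝒯 ψ (h ∘ inj₂)
  Sat 𝒯 (φ ∨ ψ)    h = Σ[ 𝒮 ∈ Team _ _ ] Σ[ 𝒰 ∈ Team _ _ ]
    member 𝒯 ≐ member 𝒮 ∪ member 𝒰 × Sat 𝒮 φ (h ∘ inj₁) × Sat 𝒰 ψ (h ∘ inj₂)
  Sat 𝒯 (∃⟨ x ⟩ φ) h = Σ[ f ∈ Choice 𝒯 ] Sat (supplement 𝒯 x f) φ (bind h)
  Sat 𝒯 (∀⟨ x ⟩ φ) h = Sat (supplement 𝒯 x (everything 𝒯 (point 𝒜))) φ (bind h)

SatisfiableIn : ∀ {τ} → Structure τ → FO∼ τ → Set₁
SatisfiableIn 𝒜 φ =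
  Σ[ X ∈ Pred Var 0ℓ ] Σ[ 𝒯 ∈ Team X (dom 𝒜) ] Σ[ h ∈ Free φ ⊆ X ] Sat 𝒜 𝒯 φ h

IsSatisfiable : ∀ {τ} → FO∼ τ → Set₁
IsSatisfiable {τ} φ = Σ[ 𝒜 ∈ Structure τ ] SatisfiableIn 𝒜 φ

{-# OPTIONS --safe #-}
-- Whether a team satisfies φ depends only on which types its assignments have
-- in the two-pebble game with |φ| rounds, so it suffices to find a small structure
-- realising the same game types of pairs.  Colour the elements of the given structure
-- by their game type.  Call an element a king if no other element has its
-- colour; the new structure keeps the kings.  The other elements are classified by
-- colour and by their atomic types with all kings, and each class contributes
-- three layers of copies, one copy per layer and atomic type.  A commoner finds the
-- witnesses it needs among the kings and in the next layer, where one copy is reserved for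
-- each atomic type; kings find theirs because the classes remember the kings.
-- An element type of rank j + 1 is a set of pairs of an atomic type and an element
-- type of rank j, so that each rank costs a bounded number of exponentials.
module Submission where

open import Defs
open import Axiom.ExcludedMiddle using (ExcludedMiddle)
open import Data.Bool.Base using (Bool; true; false; not; if_then_else_)
open import Data.Empty using (⊥-elim; ⊥-elim-irr)
open import Data.Fin.Base using (Fin; zero; suc; combine; remQuot; funToFin; finToFun; _<_)
open import Data.Fin.Properties using (<-cmp; combine-injectiveˡ; combine-injectiveʳ; remQuot-combine; finToFun-funToFin; suc-injective; +↔⊎; *↔×)
open import Data.List.Base as List using (List; []; _∷_; _++_; length)
open import Data.List.Membership.Propositional using () renaming (_∈_ to _∈ˡ_)
open import Data.List.Membership.Propositional.Properties using (∈-++⁺ˡ; ∈-++⁺ʳ; ∈-map⁺)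
open import Data.List.Properties using (length-map; length-++)
open import Data.List.Relation.Binary.Subset.Propositional using () renaming (_⊆_ to _⊆ˡ_)
open import Data.List.Relation.Unary.Any as Any using (here; there)
open import Data.List.Relation.Unary.Any.Properties using (lookup-index)
open import Data.Nat.Base using (ℕ; zero; suc; _+_; _*_; _^_; _≤_; z≤n; s≤s)
open import Data.Nat.Properties using (_≟_; ≤-refl; ≤-trans; ≤-reflexive; m≤m+n; m≤n+m; n≤1+n; +-mono-≤; *-mono-≤; +-identityʳ; ^-monoʳ-≤; ^-monoˡ-≤; ^-*-assoc; ^-distribˡ-+-*; m^n>0; m≤n⇒m<n∨m≡n; module ≤-Reasoning)
open import Data.Nat.Tactic.RingSolver using (solve-∀)
open import Data.Product.Base using (Σ-syntax; ∃-syntax; _×_; _,_; proj₁; proj₂)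
open import Data.Sum.Base using (_⊎_; inj₁; inj₂)
open import Data.Sum.Function.Propositional using (_⊎-↔_)
open import Data.Unit.Base using (tt)
open import Data.Vec.Base as Vec using (Vec; []; _∷_; lookup)
open import Data.Vec.Properties using (lookup-map)
open import Function.Base using (_∘_; id)
open import Function.Bundles using (_↔_)
open import Function.Construct.Composition using (_↔-∘_)
open import Function.Construct.Identity using (↔-id)
open import Function.Construct.Symmetry using (↔-sym)
open import Level using (0ℓ; lift; lower) renaming (suc to lsuc)
open import Relation.Binary.Definitions using (Tri; tri<; tri≈; tri>)
open import Relation.Binary.PropositionalEquality using (_≡_; _≢_; refl; sym; trans; cong; cong₂; subst)
open import Relation.Nullary using (¬_; Dec; yes; no; does; contradiction)
open import Relation.Nullary.Decidable using (map′; decidable-stable; dec-true; dec-false)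
open import Relation.Unary using (Pred; _∈_; _⊆_; _∪_; ｛_｝)

-- Words over two letters, naming tuples over a pair of elements.

pick : {A : Set} → A → A → Bool → A
pick a b w = if w then a else b

pick-diagonal : {A : Set} (a : A) → ∀ w → pick a a w ≡ a
pick-diagonal a true  = refl
pick-diagonal a false = refl

pick-not : {A : Set} (a b : A) → ∀ w → pick a b (not w) ≡ pick b a w
pick-not a b true  = refl
pick-not a b false = refl

-- Two positions that show distinct elements reveal both members of the pair, so only the order
-- remains open. Hence a tuple with two distinct entries is spelled by one unordered pair.
pick-determined : {A : Set} {a b c d : A} → ∀ p q p′ q′ →
  pick a b p ≡ pick c d p′ → pick a b q ≡ pick c d q′ → pick a b p ≢ pick a b q →
  (a ≡ c × b ≡ d) ⊎ (a ≡ d × b ≡ c)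
pick-determined true  true  _     _     _ _ ≢ = contradiction refl ≢
pick-determined false false _     _     _ _ ≢ = contradiction refl ≢
pick-determined true  false true  true  h k ≢ = contradiction (trans h (sym k)) ≢
pick-determined true  false false false h k ≢ = contradiction (trans h (sym k)) ≢
pick-determined false true  true  true  h k ≢ = contradiction (trans h (sym k)) ≢
pick-determined false true  false false h k ≢ = contradiction (trans h (sym k)) ≢
pick-determined true  false true  false h k _ = inj₁ (h , k)
pick-determined true  false false true  h k _ = inj₂ (h , k)
pick-determined false true  true  false h k _ = inj₂ (k , h)
pick-determined false true  false true  h k _ = inj₁ (k , h)

map-cong-lookup : {A B C : Set} {f : A → C} {g : B → C} → ∀ {n} (v : Vec A n) (w : Vec B n) →
  (∀ i → f (lookup v i) ≡ g (lookup w i)) → Vec.map f v ≡ Vec.map g w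
map-cong-lookup []      []      _ = refl
map-cong-lookup (a ∷ v) (b ∷ w) h = cong₂ _∷_ (h zero) (map-cong-lookup v w (h ∘ suc))

lookup-cong-map : {A B C : Set} {f : A → C} {g : B → C} → ∀ {n} (v : Vec A n) (w : Vec B n) →
  Vec.map f v ≡ Vec.map g w → ∀ i → f (lookup v i) ≡ g (lookup w i)
lookup-cong-map {f = f} {g} v w eq i =
  trans (sym (lookup-map i f v)) (trans (cong (λ u → lookup u i) eq) (lookup-map i g w))

words : ∀ n → List (Vec Bool n)
words zero    = [] ∷ []
words (suc n) = List.map (true ∷_) (words n) ++ List.map (false ∷_) (words n)

∈-words : ∀ {n} (w : Vec Bool n) → w ∈ˡ words n
∈-words []          = here refl
∈-words (true  ∷ w) = ∈-++⁺ˡ (∈-map⁺ (true ∷_) (∈-words w))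
∈-words (false ∷ w) = ∈-++⁺ʳ (List.map (true ∷_) (words _)) (∈-map⁺ (false ∷_) (∈-words w))

length-words : ∀ n → length (words n) ≡ 2 ^ n
length-words zero    = refl
length-words (suc n) = trans (length-++ (List.map (true ∷_) (words n)))
  (cong₂ _+_ (trans (length-map (true ∷_) (words n)) (length-words n))
    (trans (length-map (false ∷_) (words n)) (trans (length-words n) (sym (+-identityʳ (2 ^ n))))))

-- Atoms of a formula and the two-pebble game.

module _ {τ : Vocabulary} where

  -- (R , w) stands for the atom whose i-th argument is x or y according to wᵢ.
  Atom : Set
  Atom = Σ[ R ∈ PredSym τ ] Vec Bool (predArity τ R)

  foAtoms : FO τ → List Atom
  foAtoms (pred R ts)   = List.map (λ w → R , w) (words (predArity τ R))
  foAtoms (equal _ t u) = []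
  foAtoms (¬̇ α)         = foAtoms α
  foAtoms (α ∧̇ β)       = foAtoms α ++ foAtoms β
  foAtoms (α ∨̇ β)       = foAtoms α ++ foAtoms β
  foAtoms (∃̇⟨ x ⟩ α)    = foAtoms α
  foAtoms (∀̇⟨ x ⟩ α)    = foAtoms α

  atoms : FO∼ τ → List Atom
  atoms (fo α)     = foAtoms α
  atoms (∼ φ)      = atoms φ
  atoms (φ ∧ ψ)    = atoms φ ++ atoms ψ
  atoms (φ ∨ ψ)    = atoms φ ++ atoms ψ
  atoms (∃⟨ x ⟩ φ) = atoms φ
  atoms (∀⟨ x ⟩ φ) = atoms φ

  1≤termLength : (t : Term τ) → 1 ≤ termLength t
  1≤termLength (var x)    = s≤s z≤n
  1≤termLength (fun f ts) = s≤s z≤n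

  n≤termsLength : ∀ {n} (ts : Vec (Term τ) n) → n ≤ termsLength ts
  n≤termsLength []       = z≤n
  n≤termsLength (t ∷ ts) = +-mono-≤ (1≤termLength t) (n≤termsLength ts)

  private
    ++-bound : (xs ys : List Atom) → ∀ m n → length xs ≤ 2 ^ m → length ys ≤ 2 ^ n →
      length (xs ++ ys) ≤ 2 ^ (1 + m + n)
    ++-bound xs ys m n p q = begin
      length (xs ++ ys)               ≡⟨ length-++ xs ⟩
      length xs + length ys           ≤⟨ +-mono-≤ p q ⟩
      2 ^ m + 2 ^ n                   ≤⟨ +-mono-≤ (^-monoʳ-≤ 2 (m≤m+n m n)) (^-monoʳ-≤ 2 (m≤n+m n m)) ⟩
      2 ^ (m + n) + 2 ^ (m + n)       ≡⟨ cong (2 ^ (m + n) +_) (sym (+-identityʳ _)) ⟩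
      2 ^ (1 + m + n)                 ∎
      where open ≤-Reasoning

    weaken : ∀ {k} n m → k ≤ 2 ^ m → k ≤ 2 ^ (n + m)
    weaken n m p = ≤-trans p (^-monoʳ-≤ 2 (m≤n+m m n))

  -- An atom of arity r contributes 2^r words, and its r arguments cost at least r symbols. For
  -- binary connectives, the symbol itself pays for the sum of the two powers.
  length-foAtoms : (α : FO τ) → length (foAtoms α) ≤ 2 ^ foLength α
  length-foAtoms (pred R ts) = begin
    length (foAtoms (pred R ts))   ≡⟨ length-map {B = Atom} (λ w → R , w) (words (predArity τ R)) ⟩
    length (words (predArity τ R))                   ≡⟨ length-words (predArity τ R) ⟩
    2 ^ predArity τ R                                ≤⟨ ^-monoʳ-≤ 2 (≤-trans (n≤termsLength ts) (n≤1+n _)) ⟩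
    2 ^ foLength (pred {τ} R ts)                     ∎
    where open ≤-Reasoning
  length-foAtoms (equal _ t u) = z≤n
  length-foAtoms (¬̇ α)         = weaken 1 (foLength α) (length-foAtoms α)
  length-foAtoms (α ∧̇ β)       = ++-bound (foAtoms α) (foAtoms β) (foLength α) (foLength β) (length-foAtoms α) (length-foAtoms β)
  length-foAtoms (α ∨̇ β)       = ++-bound (foAtoms α) (foAtoms β) (foLength α) (foLength β) (length-foAtoms α) (length-foAtoms β)
  length-foAtoms (∃̇⟨ x ⟩ α)    = weaken 2 (foLength α) (length-foAtoms α)
  length-foAtoms (∀̇⟨ x ⟩ α)    = weaken 2 (foLength α) (length-foAtoms α)

  length-atoms : (φ : FO∼ τ) → length (atoms φ) ≤ 2 ^ ∣ φ ∣
  length-atoms (fo α)     = length-foAtoms α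
  length-atoms (∼ φ)      = weaken 1 ∣ φ ∣ (length-atoms φ)
  length-atoms (φ ∧ ψ)    = ++-bound (atoms φ) (atoms ψ) ∣ φ ∣ ∣ ψ ∣ (length-atoms φ) (length-atoms ψ)
  length-atoms (φ ∨ ψ)    = ++-bound (atoms φ) (atoms ψ) ∣ φ ∣ ∣ ψ ∣ (length-atoms φ) (length-atoms ψ)
  length-atoms (∃⟨ x ⟩ φ) = weaken 2 ∣ φ ∣ (length-atoms φ)
  length-atoms (∀⟨ x ⟩ φ) = weaken 2 ∣ φ ∣ (length-atoms φ)

  1≤∣_∣ : (φ : FO∼ τ) → 1 ≤ ∣ φ ∣
  1≤∣ fo (pred R ts) ∣   = s≤s z≤n
  1≤∣ fo (equal _ t u) ∣ = s≤s z≤n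
  1≤∣ fo (¬̇ α) ∣         = s≤s z≤n
  1≤∣ fo (α ∧̇ β) ∣       = s≤s z≤n
  1≤∣ fo (α ∨̇ β) ∣       = s≤s z≤n
  1≤∣ fo (∃̇⟨ x ⟩ α) ∣    = s≤s z≤n
  1≤∣ fo (∀̇⟨ x ⟩ α) ∣    = s≤s z≤n
  1≤∣ ∼ φ ∣              = s≤s z≤n
  1≤∣ φ ∧ ψ ∣            = s≤s z≤n
  1≤∣ φ ∨ ψ ∣            = s≤s z≤n
  1≤∣ ∃⟨ x ⟩ φ ∣         = s≤s z≤n
  1≤∣ ∀⟨ x ⟩ φ ∣         = s≤s z≤n

  Holds : (𝒜 : Structure τ) (R : PredSym τ) → Vec Bool (predArity τ R) → dom 𝒜 → dom 𝒜 → Set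
  Holds 𝒜 R w a b = Vec.map (pick a b) w ∈ ⟦_⟧pred 𝒜 R

  -- All words are demanded at once, since the arguments of an atom may follow any pattern of the
  -- two variables.
  Occurs : List Atom → PredSym τ → Set
  Occurs Λ R = ∀ w → (R , w) ∈ˡ Λ

  -- A strategy for the two-pebble game: Z j a b a′ b′ says that the duplicator
  -- survives j more rounds from the position (a , b), (a′ , b′).
  record BackForth (Λ : List Atom) (𝒜 ℬ : Structure τ) : Set₁ where
    field
      Z      : ℕ → dom 𝒜 → dom 𝒜 → dom ℬ → dom ℬ → Set
      equalᶠ : ∀ {j a b a′ b′} → Z j a b a′ b′ → a ≡ b → a′ ≡ b′
      equalᵇ : ∀ {j a b a′ b′} → Z j a b a′ b′ → a′ ≡ b′ → a ≡ b
      predᶠ  : ∀ {j a b a′ b′ R} → Occurs Λ R → Z j a b a′ b′ → ∀ w → Holds 𝒜 R w a b → Holds ℬ R w a′ b′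
      predᵇ  : ∀ {j a b a′ b′ R} → Occurs Λ R → Z j a b a′ b′ → ∀ w → Holds ℬ R w a′ b′ → Holds 𝒜 R w a b
      leftᶠ  : ∀ {j a b a′ b′} → Z (suc j) a b a′ b′ → ∀ c → ∃[ c′ ] Z j c b c′ b′
      leftᵇ  : ∀ {j a b a′ b′} → Z (suc j) a b a′ b′ → ∀ c′ → ∃[ c ] Z j c b c′ b′
      rightᶠ : ∀ {j a b a′ b′} → Z (suc j) a b a′ b′ → ∀ c → ∃[ c′ ] Z j a c a′ c′
      rightᵇ : ∀ {j a b a′ b′} → Z (suc j) a b a′ b′ → ∀ c′ → ∃[ c ] Z j a c a′ c′

  -- Preservation is proved as an implication only; negation is treated by exchanging the two
  -- structures.
  flip : {Λ : List Atom} {𝒜 ℬ : Structure τ} → BackForth Λ 𝒜 ℬ → BackForth Λ ℬ 𝒜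
  flip 𝒵 = record
    { Z      = λ j a b a′ b′ → Z j a′ b′ a b
    ; equalᶠ = equalᵇ ; equalᵇ = equalᶠ
    ; predᶠ  = predᵇ  ; predᵇ  = predᶠ
    ; leftᶠ  = leftᵇ  ; leftᵇ  = leftᶠ
    ; rightᶠ = rightᵇ ; rightᵇ = rightᶠ
    }
    where open BackForth 𝒵

-- Game equivalence preserves first-order and team satisfaction.

update-cong : ∀ {X A} {s t : Assignment X A} z {a} → Pointwise X A s t →
  Pointwise (X ∪ ｛ z ｝) A (s [ z ↦ a ]) (t [ z ↦ a ])
update-cong {X} z s≗t v v∈ with z ≟ v
... | yes _   = refl
... | no  z≢v = s≗t v (∪-drop {X} z≢v v∈)

module _ (x y : Var) where

  -- X need not contain x and y.
  Reads : ∀ {X A} → Assignment X A → A → A → Set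
  Reads {X} s a b = (.(x∈X : x ∈ X) → s x x∈X ≡ a) × (.(y∈X : y ∈ X) → s y y∈X ≡ b)

  reads-resp : ∀ {X A} {s t : Assignment X A} {a b} → Pointwise X A s t → Reads s a b → Reads t a b
  reads-resp s≗t (p , q) =
    (λ x∈X → trans (sym (s≗t x x∈X)) (p x∈X)) , (λ y∈X → trans (sym (s≗t y y∈X)) (q y∈X))

  module _ (x≢y : x ≢ y) where

    reads-pick : ∀ {X A} {s : Assignment X A} {a b v} → Reads s a b → v ∈ˡ x ∷ y ∷ [] →
      .(v∈X : v ∈ X) → s v v∈X ≡ pick a b (does (v ≟ x))
    reads-pick {a = a} {b} (p , q) (here refl) v∈X =
      trans (p v∈X) (cong (pick a b) (sym (dec-true (x ≟ x) refl)))
    reads-pick {a = a} {b} (p , q) (there (here refl)) v∈X =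
      trans (q v∈X) (cong (pick a b) (sym (dec-false (y ≟ x) (x≢y ∘ sym))))

    reads-updateˡ : ∀ {X A} {s : Assignment X A} {a b} c → Reads s a b → Reads (s [ x ↦ c ]) c b
    reads-updateˡ {X} {s = s} {b = b} c (p , q) = updated , kept
      where
      updated : .(x∈ : x ∈ X ∪ ｛ x ｝) → (s [ x ↦ c ]) x x∈ ≡ c
      updated _ with x ≟ x
      ... | yes _   = refl
      ... | no  x≢x = contradiction refl x≢x
      kept : .(y∈ : y ∈ X ∪ ｛ x ｝) → (s [ x ↦ c ]) y y∈ ≡ b
      kept y∈ with x ≟ y
      ... | yes x≡y = contradiction x≡y x≢y
      ... | no  _   = q (∪-drop {X} x≢y y∈)

    reads-updateʳ : ∀ {X A} {s : Assignment X A} {a b} c → Reads s a b → Reads (s [ y ↦ c ]) a c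
    reads-updateʳ {X} {s = s} {a = a} c (p , q) = kept , updated
      where
      updated : .(y∈ : y ∈ X ∪ ｛ y ｝) → (s [ y ↦ c ]) y y∈ ≡ c
      updated _ with y ≟ y
      ... | yes _   = refl
      ... | no  y≢y = contradiction refl y≢y
      kept : .(x∈ : x ∈ X ∪ ｛ y ｝) → (s [ y ↦ c ]) x x∈ ≡ a
      kept x∈ with y ≟ x
      ... | yes y≡x = contradiction (sym y≡x) x≢y
      ... | no  _   = p (∪-drop {X} (x≢y ∘ sym) x∈)

    module _ {τ : Vocabulary} (relational : Relational τ) {Λ : List (Atom {τ})} where

      word : ∀ {n} → Vec (Term τ) n → Vec Bool n
      word = Vec.map λ { (var v) → does (v ≟ x) ; (fun f _) → ⊥-elim (relational f) }

      evals-word : (𝒜 : Structure τ) → ∀ {X n} {s : Assignment X (dom 𝒜)} {a b} → Reads s a b →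
        (ts : Vec (Term τ) n) .(h : (_∈ˡ termsVars ts) ⊆ X) → termsVars ts ⊆ˡ x ∷ y ∷ [] →
        evals 𝒜 s ts h ≡ Vec.map (pick a b) (word ts)
      evals-word 𝒜 r []             h xy = refl
      evals-word 𝒜 r (var v ∷ ts)   h xy =
        cong₂ _∷_ (reads-pick r (xy (here refl)) (h (here refl))) (evals-word 𝒜 r ts (h ∘ there) (xy ∘ there))
      evals-word 𝒜 r (fun f _ ∷ ts) h xy = ⊥-elim (relational f)

      -- The pebble positions are existentially given because an assignment need not define both
      -- variables.
      record Match {𝒜 ℬ : Structure τ} (𝒵 : BackForth Λ 𝒜 ℬ) (j : ℕ) {X Y : Pred Var 0ℓ}
                   (s : Assignment X (dom 𝒜)) (s′ : Assignment Y (dom ℬ)) : Set where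
        constructor matching
        field
          {a b}   : dom 𝒜
          {a′ b′} : dom ℬ
          reads   : Reads s a b
          reads′  : Reads s′ a′ b′
          related : BackForth.Z 𝒵 j a b a′ b′

      module _ {𝒜 ℬ : Structure τ} (𝒵 : BackForth Λ 𝒜 ℬ) where
        open BackForth 𝒵

        match-flip : ∀ {j X Y} {s : Assignment X (dom 𝒜)} {s′ : Assignment Y (dom ℬ)} →
          Match 𝒵 j s s′ → Match (flip 𝒵) j s′ s
        match-flip (matching r r′ z) = matching r′ r z

        match-resp : ∀ {j X Y} {s t : Assignment X (dom 𝒜)} {s′ t′ : Assignment Y (dom ℬ)} →
          Pointwise X (dom 𝒜) s t → Pointwise Y (dom ℬ) s′ t′ → Match 𝒵 j s s′ → Match 𝒵 j t t′
        match-resp s≗t s′≗t′ (matching r r′ z) =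
          matching (reads-resp s≗t r) (reads-resp s′≗t′ r′) z

        match-forth : ∀ {j X Y z} {s : Assignment X (dom 𝒜)} {s′ : Assignment Y (dom ℬ)} →
          z ∈ˡ x ∷ y ∷ [] → Match 𝒵 (suc j) s s′ → ∀ c → ∃[ c′ ] Match 𝒵 j (s [ z ↦ c ]) (s′ [ z ↦ c′ ])
        match-forth (here refl) (matching r r′ z) c =
          let c′ , z′ = leftᶠ z c
          in c′ , matching (reads-updateˡ c r) (reads-updateˡ c′ r′) z′
        match-forth (there (here refl)) (matching r r′ z) c =
          let c′ , z′ = rightᶠ z c
          in c′ , matching (reads-updateʳ c r) (reads-updateʳ c′ r′) z′

      match-back : ∀ {𝒜 ℬ : Structure τ} (𝒵 : BackForth Λ 𝒜 ℬ) →
        ∀ {j X Y z} {s : Assignment X (dom 𝒜)} {s′ : Assignment Y (dom ℬ)} →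
        z ∈ˡ x ∷ y ∷ [] → Match 𝒵 (suc j) s s′ → ∀ c′ → ∃[ c ] Match 𝒵 j (s [ z ↦ c ]) (s′ [ z ↦ c′ ])
      match-back 𝒵 z∈ m c′ =
        let c , m′ = match-forth (flip 𝒵) z∈ (match-flip 𝒵 m) c′ in c , match-flip (flip 𝒵) m′

      private
        split-≤ : ∀ m {n j} → 1 + m + n ≤ j → m ≤ j × n ≤ j
        split-≤ m {n} h = ≤-trans (≤-trans (m≤m+n m n) (n≤1+n _)) h , ≤-trans (≤-trans (m≤n+m n m) (n≤1+n _)) h

      equal-preserved : ∀ {𝒜 ℬ : Structure τ} (𝒵 : BackForth Λ 𝒜 ℬ) {j a b a′ b′} → BackForth.Z 𝒵 j a b a′ b′ →
        ∀ p q → pick a b p ≡ pick a b q → pick a′ b′ p ≡ pick a′ b′ q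
      equal-preserved 𝒵 z true  true  _  = refl
      equal-preserved 𝒵 z false false _  = refl
      equal-preserved 𝒵 z true  false eq = BackForth.equalᶠ 𝒵 z eq
      equal-preserved 𝒵 z false true  eq = sym (BackForth.equalᶠ 𝒵 z (sym eq))

      -- The length bounds the number of rounds still needed. Only a quantifier uses up a round, and
      -- its length of 2 more than covers it.
      tarski-preserved : ∀ {𝒜 ℬ : Structure τ} (𝒵 : BackForth Λ 𝒜 ℬ) (α : FO τ) →
        ∀ {j X Y} {s : Assignment X (dom 𝒜)} {s′ : Assignment Y (dom ℬ)} →
        foLength α ≤ j → foVars α ⊆ˡ x ∷ y ∷ [] → foAtoms α ⊆ˡ Λ → Match 𝒵 j s s′ →
        .(h : foFree α ⊆ X) .(h′ : foFree α ⊆ Y) → Tarski 𝒜 s α h → Tarski ℬ s′ α h′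
      tarski-preserved {𝒜} {ℬ} 𝒵 (pred R ts) ≤j xy at (matching r r′ z) h h′ ⊨ =
        subst (_∈ ⟦_⟧pred ℬ R) (sym (evals-word ℬ r′ ts h′ xy))
          (BackForth.predᶠ 𝒵 {R = R} (λ w → at (∈-map⁺ (λ v → R , v) (∈-words w))) z (word ts)
            (subst (_∈ ⟦_⟧pred 𝒜 R) (evals-word 𝒜 r ts h xy) ⊨))
      tarski-preserved 𝒵 (equal e (var u) (var v)) ≤j xy at (matching r r′ z) h h′ ⊨ =
        let u∈ = xy (here refl) ; v∈ = xy (there (here refl)) in
        trans (reads-pick r′ u∈ (h′ (here refl)))
          (trans (equal-preserved 𝒵 z (does (u ≟ x)) (does (v ≟ x))
              (trans (sym (reads-pick r u∈ (h (here refl))))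
                (trans ⊨ (reads-pick r v∈ (h (there (here refl)))))))
            (sym (reads-pick r′ v∈ (h′ (there (here refl))))))
      tarski-preserved 𝒵 (equal _ (fun f _) _) = ⊥-elim (relational f)
      tarski-preserved 𝒵 (equal _ (var _) (fun f _)) = ⊥-elim (relational f)
      tarski-preserved 𝒵 (¬̇ α) ≤j xy at m h h′ ¬⊨ ⊨ =
        ¬⊨ (tarski-preserved (flip 𝒵) α (≤-trans (n≤1+n _) ≤j) xy at (match-flip 𝒵 m) h′ h ⊨)
      tarski-preserved 𝒵 (α ∧̇ β) ≤j xy at m h h′ (⊨α , ⊨β) =
        let ≤α , ≤β = split-≤ (foLength α) ≤j in
        tarski-preserved 𝒵 α ≤α (xy ∘ ∈-++⁺ˡ) (at ∘ ∈-++⁺ˡ) m (h ∘ inj₁) (h′ ∘ inj₁) ⊨α ,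
        tarski-preserved 𝒵 β ≤β (xy ∘ ∈-++⁺ʳ (foVars α)) (at ∘ ∈-++⁺ʳ (foAtoms α)) m (h ∘ inj₂) (h′ ∘ inj₂) ⊨β
      tarski-preserved 𝒵 (α ∨̇ β) ≤j xy at m h h′ (inj₁ ⊨α) =
        inj₁ (tarski-preserved 𝒵 α (proj₁ (split-≤ (foLength α) ≤j)) (xy ∘ ∈-++⁺ˡ) (at ∘ ∈-++⁺ˡ) m (h ∘ inj₁) (h′ ∘ inj₁) ⊨α)
      tarski-preserved 𝒵 (α ∨̇ β) ≤j xy at m h h′ (inj₂ ⊨β) =
        inj₂ (tarski-preserved 𝒵 β (proj₂ (split-≤ (foLength α) ≤j)) (xy ∘ ∈-++⁺ʳ (foVars α)) (at ∘ ∈-++⁺ʳ (foAtoms α)) m (h ∘ inj₂) (h′ ∘ inj₂) ⊨β)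
      tarski-preserved 𝒵 (∃̇⟨ z ⟩ α) (s≤s ≤j) xy at m h h′ (c , ⊨) =
        let c′ , m′ = match-forth 𝒵 (xy (here refl)) m c in
        c′ , tarski-preserved 𝒵 α (≤-trans (n≤1+n _) ≤j) (xy ∘ there) at m′ (bind h) (bind h′) ⊨
      tarski-preserved 𝒵 (∀̇⟨ z ⟩ α) (s≤s ≤j) xy at m h h′ ⊨ c′ =
        let c , m′ = match-back 𝒵 (xy (here refl)) m c′ in
        tarski-preserved 𝒵 α (≤-trans (n≤1+n _) ≤j) (xy ∘ there) at m′ (bind h) (bind h′) (⊨ c)

      -- Each assignment of either team has a partner. The number of partners is left free: the
      -- parts of a split may overlap and a choice may take several values, so multiplicities cannot
      -- be observed.
      record TeamMatch {𝒜 ℬ : Structure τ} (𝒵 : BackForth Λ 𝒜 ℬ) (j : ℕ) {X Y : Pred Var 0ℓ}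
                       (𝒯 : Team X (dom 𝒜)) (𝒯′ : Team Y (dom ℬ)) : Set where
        constructor _,_
        field
          forth : ∀ s → s ∈ member 𝒯 → ∃[ s′ ] s′ ∈ member 𝒯′ × Match 𝒵 j s s′
          back  : ∀ s′ → s′ ∈ member 𝒯′ → ∃[ s ] s ∈ member 𝒯 × Match 𝒵 j s s′

      open TeamMatch

      module _ {𝒜 ℬ : Structure τ} (𝒵 : BackForth Λ 𝒜 ℬ) {j : ℕ} {X Y : Pred Var 0ℓ} where

        teamMatch-flip : {𝒯 : Team X (dom 𝒜)} {𝒯′ : Team Y (dom ℬ)} →
          TeamMatch 𝒵 j 𝒯 𝒯′ → TeamMatch (flip 𝒵) j 𝒯′ 𝒯
        teamMatch-flip tm =
          (λ s′ s′∈ → let s , s∈ , m = back tm s′ s′∈ in s , s∈ , match-flip 𝒵 m) ,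
          (λ s s∈ → let s′ , s′∈ , m = forth tm s s∈ in s′ , s′∈ , match-flip 𝒵 m)

        -- Transports one part of a split. An assignment with partners in both parts goes to both,
        -- which a split permits.
        matched : Team Y (dom ℬ) → Team X (dom 𝒜) → Team Y (dom ℬ)
        matched 𝒯′ 𝒮 .member s′ = s′ ∈ member 𝒯′ × ∃[ s ] s ∈ member 𝒮 × Match 𝒵 j s s′
        matched 𝒯′ 𝒮 .member-resp s′≗t′ (s′∈ , s , s∈ , m) =
          member-resp 𝒯′ s′≗t′ s′∈ , s , s∈ , match-resp 𝒵 (λ _ _ → refl) s′≗t′ m

        teamMatch-matched : {𝒯 𝒮 : Team X (dom 𝒜)} {𝒯′ : Team Y (dom ℬ)} → TeamMatch 𝒵 j 𝒯 𝒯′ →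
          member 𝒮 ⊆ member 𝒯 → TeamMatch 𝒵 j 𝒮 (matched 𝒯′ 𝒮)
        teamMatch-matched tm 𝒮⊆𝒯 =
          (λ s s∈ → let s′ , s′∈ , m = forth tm s (𝒮⊆𝒯 s∈) in s′ , (s′∈ , s , s∈ , m) , m) ,
          (λ s′ (_ , s , s∈ , m) → s , s∈ , m)

        module _ {z : Var} (z∈ : z ∈ˡ x ∷ y ∷ []) {𝒯 : Team X (dom 𝒜)} {𝒯′ : Team Y (dom ℬ)}
                 (tm : TeamMatch 𝒵 (suc j) 𝒯 𝒯′) where

          -- All values whose update matches some update chosen by `f` are taken, so that going back
          -- is immediate; a forth move of the game shows that there is such a value.
          matchedChoice : Choice 𝒯 → Choice 𝒯′
          matchedChoice f .values s′ c′ =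
            ∃[ s ] ∃[ c ] s ∈ member 𝒯 × c ∈ values f s × Match 𝒵 j (s [ z ↦ c ]) (s′ [ z ↦ c′ ])
          matchedChoice f .values-resp s′≗t′ (s , c , s∈ , c∈ , m) =
            s , c , s∈ , c∈ , match-resp 𝒵 (λ _ _ → refl) (update-cong z s′≗t′) m
          matchedChoice f .nonempty {s′} s′∈ =
            let s , s∈ , m = back tm s′ s′∈ ; c , c∈ = nonempty f s∈ ; c′ , m′ = match-forth 𝒵 z∈ m c
            in c′ , s , c , s∈ , c∈ , m′

          teamMatch-supplement : (f : Choice 𝒯) →
            TeamMatch 𝒵 j (supplement 𝒯 z f) (supplement 𝒯′ z (matchedChoice f))
          teamMatch-supplement f =
            (λ t (s , c , s∈ , c∈ , t≗) →
              let s′ , s′∈ , m = forth tm s s∈ ; c′ , m′ = match-forth 𝒵 z∈ m c in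
              s′ [ z ↦ c′ ] , (s′ , c′ , s′∈ , (s , c , s∈ , c∈ , m′) , λ _ _ → refl) ,
              match-resp 𝒵 (λ v v∈ → sym (t≗ v v∈)) (λ _ _ → refl) m′) ,
            (λ t′ (s′ , c′ , s′∈ , (s , c , s∈ , c∈ , m) , t′≗) →
              s [ z ↦ c ] , (s , c , s∈ , c∈ , λ _ _ → refl) ,
              match-resp 𝒵 (λ _ _ → refl) (λ v v∈ → sym (t′≗ v v∈)) m)

          teamMatch-everything : TeamMatch 𝒵 j (supplement 𝒯 z (everything 𝒯 (point 𝒜)))
                                               (supplement 𝒯′ z (everything 𝒯′ (point ℬ)))
          teamMatch-everything =
            (λ t (s , c , s∈ , _ , t≗) →
              let s′ , s′∈ , m = forth tm s s∈ ; c′ , m′ = match-forth 𝒵 z∈ m c in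
              s′ [ z ↦ c′ ] , (s′ , c′ , s′∈ , tt , λ _ _ → refl) ,
              match-resp 𝒵 (λ v v∈ → sym (t≗ v v∈)) (λ _ _ → refl) m′) ,
            (λ t′ (s′ , c′ , s′∈ , _ , t′≗) →
              let s , s∈ , m = back tm s′ s′∈ ; c , m′ = match-back 𝒵 z∈ m c′ in
              s [ z ↦ c ] , (s , c , s∈ , tt , λ _ _ → refl) ,
              match-resp 𝒵 (λ _ _ → refl) (λ v v∈ → sym (t′≗ v v∈)) m′)

      -- Induction as in the Tarski case, with `∼` exchanging the structures. The flat clause needs
      -- only a partner for each assignment of the second team, while splits and quantifiers carry
      -- teams along in both directions.
      sat-preserved : ∀ {𝒜 ℬ : Structure τ} (𝒵 : BackForth Λ 𝒜 ℬ) (φ : FO∼ τ) →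
        ∀ {j X Y} {𝒯 : Team X (dom 𝒜)} {𝒯′ : Team Y (dom ℬ)} →
        ∣ φ ∣ ≤ j → vars φ ⊆ˡ x ∷ y ∷ [] → atoms φ ⊆ˡ Λ → TeamMatch 𝒵 j 𝒯 𝒯′ →
        .(h : Free φ ⊆ X) .(h′ : Free φ ⊆ Y) → Sat 𝒜 𝒯 φ h → Sat ℬ 𝒯′ φ h′
      sat-preserved 𝒵 (fo α) ≤j xy at tm h h′ (lift ⊨) = lift λ s′ s′∈ →
        let s , s∈ , m = back tm s′ s′∈ in tarski-preserved 𝒵 α ≤j xy at m h h′ (⊨ s s∈)
      sat-preserved 𝒵 (∼ φ) ≤j xy at tm h h′ ¬⊨ ⊨ =
        ¬⊨ (sat-preserved (flip 𝒵) φ (≤-trans (n≤1+n _) ≤j) xy at (teamMatch-flip 𝒵 tm) h′ h ⊨)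
      sat-preserved 𝒵 (φ ∧ ψ) ≤j xy at tm h h′ (⊨φ , ⊨ψ) =
        let ≤φ , ≤ψ = split-≤ ∣ φ ∣ ≤j in
        sat-preserved 𝒵 φ ≤φ (xy ∘ ∈-++⁺ˡ) (at ∘ ∈-++⁺ˡ) tm (h ∘ inj₁) (h′ ∘ inj₁) ⊨φ ,
        sat-preserved 𝒵 ψ ≤ψ (xy ∘ ∈-++⁺ʳ (vars φ)) (at ∘ ∈-++⁺ʳ (atoms φ)) tm (h ∘ inj₂) (h′ ∘ inj₂) ⊨ψ
      sat-preserved 𝒵 (φ ∨ ψ) {𝒯′ = 𝒯′} ≤j xy at tm h h′ (𝒮 , 𝒰 , (⊆∪ , ∪⊆) , ⊨φ , ⊨ψ) =
        let ≤φ , ≤ψ = split-≤ ∣ φ ∣ ≤j in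
        matched 𝒵 𝒯′ 𝒮 , matched 𝒵 𝒯′ 𝒰 , (covered , λ { (inj₁ (s′∈ , _)) → s′∈ ; (inj₂ (s′∈ , _)) → s′∈ }) ,
        sat-preserved 𝒵 φ ≤φ (xy ∘ ∈-++⁺ˡ) (at ∘ ∈-++⁺ˡ)
          (teamMatch-matched 𝒵 tm (∪⊆ ∘ inj₁)) (h ∘ inj₁) (h′ ∘ inj₁) ⊨φ ,
        sat-preserved 𝒵 ψ ≤ψ (xy ∘ ∈-++⁺ʳ (vars φ)) (at ∘ ∈-++⁺ʳ (atoms φ))
          (teamMatch-matched 𝒵 tm (∪⊆ ∘ inj₂)) (h ∘ inj₂) (h′ ∘ inj₂) ⊨ψ
        where
        covered : member 𝒯′ ⊆ member (matched 𝒵 𝒯′ 𝒮) ∪ member (matched 𝒵 𝒯′ 𝒰)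
        covered {s′} s′∈ with back tm s′ s′∈
        ... | s , s∈ , m with ⊆∪ s∈
        ...   | inj₁ s∈𝒮 = inj₁ (s′∈ , s , s∈𝒮 , m)
        ...   | inj₂ s∈𝒰 = inj₂ (s′∈ , s , s∈𝒰 , m)
      sat-preserved 𝒵 (∃⟨ z ⟩ φ) (s≤s ≤j) xy at tm h h′ (f , ⊨) =
        matchedChoice 𝒵 (xy (here refl)) tm f ,
        sat-preserved 𝒵 φ (≤-trans (n≤1+n _) ≤j) (xy ∘ there) at
          (teamMatch-supplement 𝒵 (xy (here refl)) tm f) (bind h) (bind h′) ⊨
      sat-preserved 𝒵 (∀⟨ z ⟩ φ) (s≤s ≤j) xy at tm h h′ ⊨ =
        sat-preserved 𝒵 φ (≤-trans (n≤1+n _) ≤j) (xy ∘ there) at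
          (teamMatch-everything 𝒵 (xy (here refl)) tm) (bind h) (bind h′) ⊨

-- Numbers of types, and a tournament for the commoners.

-- The truth values of equality and of n atoms, at (a , b) and at (b , a).
atomicTypes : ℕ → ℕ
atomicTypes n = 2 ^ suc n * 2 ^ suc n

elementTypes : ℕ → ℕ → ℕ
elementTypes n zero    = atomicTypes n
elementTypes n (suc j) = 2 ^ (atomicTypes n * elementTypes n j)

-- A tournament in which every element has a ⊏-successor with any prescribed
-- first component; this is what the three cyclically arranged layers are for.
data _⊏_ {n : ℕ} : Fin n × Fin 3 → Fin n × Fin 3 → Set where
  layer : ∀ {i j k} → i < j → (i , k) ⊏ (j , k)
  0⊏1   : ∀ {i j} → (i , zero) ⊏ (j , suc zero)
  1⊏2   : ∀ {i j} → (i , suc zero) ⊏ (j , suc (suc zero))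
  2⊏0   : ∀ {i j} → (i , suc (suc zero)) ⊏ (j , zero)

⊏-compare-layer : ∀ {n k} (i j : Fin n) → Tri ((i , k) ⊏ (j , k)) ((i , k) ≡ (j , k)) ((j , k) ⊏ (i , k))
⊏-compare-layer i j with <-cmp i j
... | tri< i<j i≢j j≮i = tri< (layer i<j) (i≢j ∘ cong proj₁) λ { (layer j<i) → j≮i j<i }
... | tri≈ i≮j i≡j j≮i = tri≈ (λ { (layer i<j) → i≮j i<j }) (cong (_, _) i≡j) (λ { (layer j<i) → j≮i j<i })
... | tri> i≮j i≢j j<i = tri> (λ { (layer i<j) → i≮j i<j }) (i≢j ∘ cong proj₁) (layer j<i)

⊏-compare : ∀ {n} (u v : Fin n × Fin 3) → Tri (u ⊏ v) (u ≡ v) (v ⊏ u)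
⊏-compare (i , zero)           (j , zero)           = ⊏-compare-layer i j
⊏-compare (i , zero)           (j , suc zero)       = tri< 0⊏1 (λ ()) (λ ())
⊏-compare (i , zero)           (j , suc (suc zero)) = tri> (λ ()) (λ ()) 2⊏0
⊏-compare (i , suc zero)       (j , zero)           = tri> (λ ()) (λ ()) 0⊏1
⊏-compare (i , suc zero)       (j , suc zero)       = ⊏-compare-layer i j
⊏-compare (i , suc zero)       (j , suc (suc zero)) = tri< 1⊏2 (λ ()) (λ ())
⊏-compare (i , suc (suc zero)) (j , zero)           = tri< 2⊏0 (λ ()) (λ ())
⊏-compare (i , suc (suc zero)) (j , suc zero)       = tri> (λ ()) (λ ()) 1⊏2
⊏-compare (i , suc (suc zero)) (j , suc (suc zero)) = ⊏-compare-layer i j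

above : Fin 3 → Fin 3
above zero             = suc zero
above (suc zero)       = suc (suc zero)
above (suc (suc zero)) = zero

⊏-above : ∀ {n} (u : Fin n × Fin 3) {j} → u ⊏ (j , above (proj₂ u))
⊏-above (i , zero)           = 0⊏1
⊏-above (i , suc zero)       = 1⊏2
⊏-above (i , suc (suc zero)) = 2⊏0

-- Coding predicates by numbers and choosing representatives, by excluded middle.

module Classical (em : ∀ {P : Set} → Dec P) where

  bit : Set → Fin 2
  bit P = if does (em {P}) then zero else suc zero

  bit-reflects : ∀ {P Q} → bit P ≡ bit Q → P → Q
  bit-reflects {P} {Q} eq p with em {P} | em {Q}
  bit-reflects eq p | _     | yes q = q
  bit-reflects eq p | no ¬p | no _  = contradiction p ¬p
  bit-reflects () p | yes _ | no _

  -- The characteristic vector of the predicates that hold at an element, as a single number; its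
  -- range supplies the bounds on numbers of types.
  code : {X : Set} {n : ℕ} → (Fin n → X → Set) → X → Fin (2 ^ n)
  code P x = funToFin (λ i → bit (P i x))

  funToFin-injective : ∀ {m n} (f g : Fin m → Fin n) → funToFin f ≡ funToFin g → ∀ i → f i ≡ g i
  funToFin-injective f g eq i =
    trans (sym (finToFun-funToFin f i)) (trans (cong (λ k → finToFun k i) eq) (finToFun-funToFin g i))

  code-reflects : {X : Set} {n : ℕ} (P : Fin n → X → Set) → ∀ {x y} → code P x ≡ code P y → ∀ i → P i x → P i y
  code-reflects P {x} {y} eq i =
    bit-reflects (funToFin-injective (λ i → bit (P i x)) (λ i → bit (P i y)) eq i)

  enumerateFin : ∀ {N} (P : Fin N → Set) → Σ[ n ∈ ℕ ] n ≤ N × Σ[ g ∈ (Fin n → Fin N) ]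
    (∀ {i j} → g i ≡ g j → i ≡ j) × (∀ i → P (g i)) × (∀ u → P u → ∃[ i ] g i ≡ u)
  enumerateFin {zero}  P = 0 , z≤n , (λ ()) , (λ {}) , (λ ()) , (λ ())
  enumerateFin {suc N} P with enumerateFin (P ∘ suc) | em {P zero}
  ... | n , n≤N , g , inj , P-g , cover | no ¬P0 =
    n , ≤-trans n≤N (n≤1+n N) , suc ∘ g , inj ∘ suc-injective , P-g ,
    λ { zero P0 → contradiction P0 ¬P0 ; (suc u) Pu → let i , eq = cover u Pu in i , cong suc eq }
  ... | n , n≤N , g , inj , P-g , cover | yes P0 =
    suc n , s≤s n≤N , g′ , inj′ , (λ { zero → P0 ; (suc i) → P-g i }) ,
    λ { zero _ → zero , refl ; (suc u) Pu → let i , eq = cover u Pu in suc i , cong suc eq }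
    where
    g′ : Fin (suc n) → Fin (suc N)
    g′ zero    = zero
    g′ (suc i) = suc (g i)
    inj′ : ∀ {i j} → g′ i ≡ g′ j → i ≡ j
    inj′ {zero}  {zero}  eq = refl
    inj′ {suc i} {suc j} eq = cong suc (inj (suc-injective eq))

  -- One element of `Q` for each value that `f` takes on `Q`. This cuts a possibly infinite domain
  -- down to at most `N` elements.
  record Representatives {A : Set} {N : ℕ} (f : A → Fin N) (Q : A → Set) : Set where
    field
      size        : ℕ
      size≤       : size ≤ N
      rep         : Fin size → A
      rep-Q       : ∀ i → Q (rep i)
      f∘rep-inj   : ∀ {i j} → f (rep i) ≡ f (rep j) → i ≡ j
      rep-cover   : ∀ a → Q a → ∃[ i ] f (rep i) ≡ f a

  representatives : {A : Set} {N : ℕ} (f : A → Fin N) (Q : A → Set) → Representatives f Q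
  representatives f Q with enumerateFin (λ u → ∃[ a ] Q a × f a ≡ u)
  ... | n , n≤N , g , inj , P-g , cover = record
    { size      = n
    ; size≤     = n≤N
    ; rep       = λ i → proj₁ (P-g i)
    ; rep-Q     = λ i → proj₁ (proj₂ (P-g i))
    ; f∘rep-inj = λ {i} {j} eq → inj (trans (sym (proj₂ (proj₂ (P-g i)))) (trans eq (proj₂ (proj₂ (P-g j)))))
    ; rep-cover = λ a q → let i , eq = cover (f a) (a , q , refl) in i , trans (proj₂ (proj₂ (P-g i))) eq
    }

  -- Atomic types of pairs and ranked types of elements.

  module Types {τ : Vocabulary} (relational : Relational τ) (𝒜 : Structure τ) (Λ : List (Atom {τ})) where

    A : Set
    A = dom 𝒜

    -- Equality is recorded for every vocabulary: it tells diagonal pairs from the others, on which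
    -- the passage from a rank to the one below relies.
    fact : Fin (suc (length Λ)) → A × A → Set
    fact zero    (a , b) = a ≡ b
    fact (suc i) (a , b) = Holds 𝒜 (proj₁ (List.lookup Λ i)) (proj₂ (List.lookup Λ i)) a b

    atomicType : A → A → Fin (atomicTypes (length Λ))
    atomicType a b = combine (code fact (a , b)) (code fact (b , a))

    private
      facts-agree : ∀ {a b a′ b′} → atomicType a b ≡ atomicType a′ b′ → code fact (a , b) ≡ code fact (a′ , b′)
      facts-agree {a} {b} {a′} {b′} = combine-injectiveˡ
        (code fact (a , b)) (code fact (b , a)) (code fact (a′ , b′)) (code fact (b′ , a′))

    atomicType-swap : ∀ {a b a′ b′} → atomicType a b ≡ atomicType a′ b′ → atomicType b a ≡ atomicType b′ a′
    atomicType-swap {a} {b} {a′} {b′} eq = cong₂ combine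
      (combine-injectiveʳ (code fact (a , b)) (code fact (b , a)) (code fact (a′ , b′)) (code fact (b′ , a′)) eq)
      (facts-agree eq)

    atomicType-equal : ∀ {a b a′ b′} → atomicType a b ≡ atomicType a′ b′ → a ≡ b → a′ ≡ b′
    atomicType-equal eq = code-reflects fact (facts-agree eq) zero

    atomicType-holds : ∀ {a b a′ b′ R} → Occurs {τ} Λ R → atomicType a b ≡ atomicType a′ b′ →
      ∀ w → Holds 𝒜 R w a b → Holds 𝒜 R w a′ b′
    atomicType-holds {a} {b} {a′} {b′} {R} occ eq w =
      subst (λ (S , v) → Holds 𝒜 S v a b → Holds 𝒜 S v a′ b′) (sym (lookup-index (occ w)))
        (code-reflects fact (facts-agree eq) (suc (Any.index (occ w))))

    elementType : ∀ j → A → Fin (elementTypes (length Λ) j)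
    elementType zero    a = atomicType a a
    elementType (suc j) = code λ i a → ∃[ b ] i ≡ combine (atomicType a b) (elementType j b)

    -- The forth move for types: the pair contributed by `b` lies in the set coded by the type of
    -- `a`, hence in that of `a′`.
    elementType-step : ∀ {j a a′} → elementType (suc j) a ≡ elementType (suc j) a′ →
      ∀ b → ∃[ b′ ] atomicType a b ≡ atomicType a′ b′ × elementType j b ≡ elementType j b′
    elementType-step {j} {a} {a′} eq b =
      let b′ , eq′ = code-reflects (λ i a → ∃[ b ] i ≡ combine (atomicType a b) (elementType j b))
                       eq (combine (atomicType a b) (elementType j b)) (b , refl)
      in b′ , combine-injectiveˡ (atomicType a b) (elementType j b) (atomicType a′ b′) (elementType j b′) eq′
            , combine-injectiveʳ (atomicType a b) (elementType j b) (atomicType a′ b′) (elementType j b′) eq′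

    -- Equality is an atom, so the type of a records the type of the one b with a = b.
    elementType-pred : ∀ {j a a′} → elementType (suc j) a ≡ elementType (suc j) a′ →
      atomicType a a ≡ atomicType a′ a′ × elementType j a ≡ elementType j a′
    elementType-pred {j} {a} {a′} eq with elementType-step {j} eq a
    ... | b′ , at≡ , el≡ with atomicType-equal at≡ refl
    ...   | refl = at≡ , el≡

    elementType-mono : ∀ {j k a a′} → j ≤ k → elementType k a ≡ elementType k a′ → elementType j a ≡ elementType j a′
    elementType-mono {j} {k} j≤k eq with m≤n⇒m<n∨m≡n j≤k
    ... | inj₂ refl = eq
    elementType-mono {j} {suc k} _ eq | inj₁ (s≤s j≤k) = elementType-mono j≤k (proj₂ (elementType-pred {k} eq))

    elementType-atomic : ∀ {k a a′} → elementType k a ≡ elementType k a′ → atomicType a a ≡ atomicType a′ a′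
    elementType-atomic {k} = elementType-mono {k = k} z≤n

    -- From a blueprint to a structure with a winning strategy.

    -- Elements of B are modelled on elements of 𝒜, and the pair d , e on the pair place d e , place e d.
    record Blueprint (K : ℕ) : Set₁ where
      field
        B            : Set
        origin       : B
        original     : B → A
        place        : B → B → A
        place-type   : ∀ d e → elementType K (place d e) ≡ elementType K (original d)
        place-equal  : ∀ {d e} → place d e ≡ place e d → d ≡ e
        witness      : ∀ d a → ∃[ e ] atomicType (original d) a ≡ atomicType (place d e) (place e d) ×
                                      elementType K a ≡ elementType K (original e)

    module Realise {K : ℕ} (blueprint : Blueprint K) where
      open Blueprint blueprint

      -- A tuple holds if some pair spelling it is placed where it holds in `𝒜`. Tuples with three
      -- or more distinct entries are spelled by no pair and fail.
      model : Structure τ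
      model .dom         = B
      model .point       = origin
      model .⟦_⟧fun f _  = ⊥-elim (relational f)
      model .⟦_⟧pred R v = ∃[ d ] ∃[ e ] ∃[ w ] v ≡ Vec.map (pick d e) w × Holds 𝒜 R w (place d e) (place e d)

      private
        placed : B → B → Bool → A
        placed d e = pick (place d e) (place e d)

        placed-type : ∀ d e p → elementType K (placed d e p) ≡ elementType K (original (pick d e p))
        placed-type d e true  = place-type d e
        placed-type d e false = place-type e d

        placed-cong : ∀ {d e} p q → pick d e p ≡ pick d e q → placed d e p ≡ placed d e q
        placed-cong true  true  _    = refl
        placed-cong false false _    = refl
        placed-cong true  false refl = refl
        placed-cong false true  refl = refl

        placed-swap : ∀ {d e} p q → pick d e p ≡ pick e d q → placed d e p ≡ placed e d q
        placed-swap {d} {e} p q eq = trans (placed-cong p (not q) (trans eq (sym (pick-not d e q)))) (pick-not _ _ q)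

        constant : ∀ {n d e} (w : Vec Bool (suc n)) → (∀ i j → pick d e (lookup w i) ≡ pick d e (lookup w j)) →
          ∀ v → let z = placed d e (lookup w zero) in Vec.map (placed d e) w ≡ Vec.map (pick z z) v
        constant w const v = map-cong-lookup w v λ i →
          trans (placed-cong (lookup w i) (lookup w zero) (const i zero)) (sym (pick-diagonal _ (lookup v i)))

        -- Only one element of the model is mentioned. Its place varies with the partner but its
        -- colour does not, and the colour fixes the atomic type of the diagonal pair.
        transfer : ∀ {R d e d′ e′} → Occurs {τ} Λ R → (w w′ : Vec Bool (predArity τ R)) →
          (∀ i → pick d e (lookup w i) ≡ pick d′ e′ (lookup w′ i)) →
          (∀ i j → pick d e (lookup w i) ≡ pick d e (lookup w j)) →
          Holds 𝒜 R w (place d e) (place e d) → Holds 𝒜 R w′ (place d′ e′) (place e′ d′)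
        transfer {R} {d} {e} {d′} {e′} occ w w′ = go (⟦_⟧pred 𝒜 R) w w′
          (λ z z′ v eq → atomicType-holds {R = R} occ (elementType-atomic {K} eq) v)
          where
          -- The arity is generalised to allow a case split on it: a nullary atom carries over
          -- directly, any other has a first entry to compare.
          go : ∀ {n} (P : Vec A n → Set) (w w′ : Vec Bool n) →
            (∀ z z′ v → elementType K z ≡ elementType K z′ → P (Vec.map (pick z z) v) → P (Vec.map (pick z′ z′) v)) →
            (∀ i → pick d e (lookup w i) ≡ pick d′ e′ (lookup w′ i)) →
            (∀ i j → pick d e (lookup w i) ≡ pick d e (lookup w j)) →
            P (Vec.map (placed d e) w) → P (Vec.map (placed d′ e′) w′)
          go {zero}  P []  []  _   _  _     holds = holds
          go {suc n} P w   w′  inv eq const holds =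
            subst P (sym (constant w′ (λ i j → trans (sym (eq i)) (trans (const i j) (eq j))) w))
              (inv _ _ w
                (trans (placed-type d e (lookup w zero))
                  (trans (cong (elementType K ∘ original) (eq zero)) (sym (placed-type d′ e′ (lookup w′ zero)))))
                (subst P (constant w const w) holds))

        -- The truth of a tuple does not depend on how it is spelled. With two distinct entries the
        -- pair is determined up to order, and so are the places; otherwise the tuple is constant.
        coherent : ∀ {R d e d′ e′} → Occurs {τ} Λ R → (w w′ : Vec Bool (predArity τ R)) →
          (∀ i → pick d e (lookup w i) ≡ pick d′ e′ (lookup w′ i)) →
          Holds 𝒜 R w (place d e) (place e d) → Holds 𝒜 R w′ (place d′ e′) (place e′ d′)
        coherent {R} {d} {e} {d′} {e′} occ w w′ eq holds
          with em {∃[ i ] ∃[ j ] pick d e (lookup w i) ≢ pick d e (lookup w j)}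
        ... | no  const = transfer {R} occ w w′ eq (λ i j → decidable-stable em λ ≢ → const (i , j , ≢)) holds
        ... | yes (i , j , ≢)
          with pick-determined (lookup w i) (lookup w j) (lookup w′ i) (lookup w′ j) (eq i) (eq j) ≢
        ...   | inj₁ (refl , refl) =
          subst (⟦_⟧pred 𝒜 R) (map-cong-lookup w w′ λ i → placed-cong (lookup w i) (lookup w′ i) (eq i)) holds
        ...   | inj₂ (refl , refl) =
          subst (⟦_⟧pred 𝒜 R) (map-cong-lookup w w′ λ i → placed-swap (lookup w i) (lookup w′ i) (eq i)) holds

      model-holds : ∀ {R d e} → ∀ w → Holds 𝒜 R w (place d e) (place e d) → Holds model R w d e
      model-holds w holds = _ , _ , w , refl , holds

      model-reflects : ∀ {R d e} → Occurs {τ} Λ R → ∀ w → Holds model R w d e → Holds 𝒜 R w (place d e) (place e d)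
      model-reflects {R} occ w (d′ , e′ , w′ , eq , holds) =
        coherent {R} occ w′ w (λ i → sym (lookup-cong-map w w′ eq i)) holds

      -- The pair has the type of the places, and each element keeps its own type of rank `j`. The
      -- bound `j≤K` lets the rank `K` facts of the blueprint be lowered to rank `j`.
      record Related (j : ℕ) (a b : A) (d e : B) : Set where
        constructor related
        field
          j≤K     : j ≤ K
          atomic≡ : atomicType a b ≡ atomicType (place d e) (place e d)
          left≡   : elementType j a ≡ elementType j (original d)
          right≡  : elementType j b ≡ elementType j (original e)

      related-swap : ∀ {j a b d e} → Related j a b d e → Related j b a e d
      related-swap (related j≤K at l r) = related j≤K (atomicType-swap at) r l

      -- The move `c` is first copied from `a` to the original of `d` inside `𝒜`; the blueprint then
      -- has a witness for the copy.
      related-forth : ∀ {j a b d e} → Related (suc j) a b d e → ∀ c → ∃[ f ] Related j a c d f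
      related-forth {j} (related j<K at l r) c =
        let c′ , at≡ , c≡c′ = elementType-step {j} l c
            f , at≡′ , c′≡f = witness _ c′
            j≤K = ≤-trans (n≤1+n j) j<K
        in f , related j≤K (trans at≡ at≡′) (proj₂ (elementType-pred {j} l)) (trans c≡c′ (elementType-mono j≤K c′≡f))

      -- The place of `d` opposite `f` has the colour of the original of `d`, so `a` can imitate the
      -- pair of places.
      related-back : ∀ {j a b d e} → Related (suc j) a b d e → ∀ f → ∃[ c ] Related j a c d f
      related-back {j} {d = d} (related j<K at l r) f =
        let j≤K = ≤-trans (n≤1+n j) j<K
            l′ = trans (elementType-mono j<K (place-type d f)) (sym l)
            c , at≡ , f≡c = elementType-step {j} l′ (place f d)
        in c , related j≤K (sym at≡) (proj₂ (elementType-pred {j} l))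
                 (trans (sym f≡c) (elementType-mono j≤K (place-type f d)))

      backForth : BackForth Λ 𝒜 model
      backForth = record
        { Z      = Related
        ; equalᶠ = λ (related _ at _ _) eq → place-equal (atomicType-equal at eq)
        ; equalᵇ = λ { (related _ at _ _) refl → atomicType-equal (sym at) refl }
        ; predᶠ  = λ {R = R} occ (related _ at _ _) w holds → model-holds {R} w (atomicType-holds {R = R} occ at w holds)
        ; predᵇ  = λ {R = R} occ (related _ at _ _) w holds →
                     atomicType-holds {R = R} occ (sym at) w (model-reflects {R} occ w holds)
        ; leftᶠ  = λ z c → let f , z′ = related-forth (related-swap z) c in f , related-swap z′
        ; leftᵇ  = λ z f → let c , z′ = related-back (related-swap z) f in c , related-swap z′
        ; rightᶠ = related-forth
        ; rightᵇ = related-back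
        }

      -- Only the colour of the witness matters here, as it determines the atomic type of the
      -- diagonal pair.
      related-start : ∀ a → ∃[ d ] Related K a a d d
      related-start a =
        let d , _ , a≡d = witness origin a
        in d , related ≤-refl (elementType-atomic {K} (trans a≡d (sym (place-type d d)))) a≡d a≡d

    -- The blueprint made of kings and commoners.

    module Construction (K : ℕ) where

      colour : A → Fin (elementTypes (length Λ) K)
      colour = elementType K

      King : A → Set
      King a = ∀ b → colour b ≡ colour a → b ≡ a

      twin : ∀ {a} → ¬ King a → ∃[ b ] a ≢ b × colour b ≡ colour a
      twin {a} ¬king with em {∃[ b ] a ≢ b × colour b ≡ colour a}
      ... | yes t = t
      ... | no ¬t = contradiction (λ b eq → sym (decidable-stable em λ a≢b → ¬t (b , a≢b , eq))) ¬king

      open Representatives (representatives colour King) public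
        renaming (size to kings; size≤ to kings≤; rep to king; rep-Q to king-King; f∘rep-inj to colour-king-injective; rep-cover to king-cover)

      king-surjective : ∀ a → King a → ∃[ i ] king i ≡ a
      king-surjective a kinga = let i , eq = king-cover a kinga in i , kinga (king i) eq

      -- The relation to each king is added to the colour, so that a king finds
      -- the witnesses it needs among the representatives of the refined colours.
      refined : A → Fin (elementTypes (length Λ) K * atomicTypes (length Λ) ^ kings)
      refined a = combine (colour a) (funToFin λ i → atomicType (king i) a)

      refined-colour : ∀ {a b} → refined a ≡ refined b → colour a ≡ colour b
      refined-colour {a} {b} = combine-injectiveˡ (colour a) (funToFin λ i → atomicType (king i) a)
                                                  (colour b) (funToFin λ i → atomicType (king i) b)

      refined-atomic : ∀ {a b} → refined a ≡ refined b → ∀ i → atomicType (king i) a ≡ atomicType (king i) b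
      refined-atomic {a} {b} eq = funToFin-injective (λ i → atomicType (king i) a) (λ i → atomicType (king i) b)
        (combine-injectiveʳ (colour a) (funToFin λ i → atomicType (king i) a)
                            (colour b) (funToFin λ i → atomicType (king i) b) eq)

      open Representatives (representatives refined (¬_ ∘ King)) public
        using (rep; rep-cover) renaming (size to classes; size≤ to classes≤; rep-Q to rep-¬King)

      -- Class and reserved type are coded in one number, whose order decides `⊏` within a layer.
      Commoner : Set
      Commoner = Fin (classes * atomicTypes (length Λ)) × Fin 3

      common : Commoner → A
      common (n , _) = rep (proj₁ (remQuot (atomicTypes (length Λ)) n))

      -- The commoner is reserved for pairs of this type with commoners ⊏-below it.
      wish : Commoner → Fin (atomicTypes (length Λ))
      wish (n , _) = proj₂ (remQuot {classes} (atomicTypes (length Λ)) n)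

      -- A candidate place for two commoners modelled on `a` and `b`. Only colours must be kept, and
      -- distinct endpoints keep equality faithful.
      record Edge (a b : A) : Set where
        field
          source target : A
          distinct      : source ≢ target
          source-colour : colour source ≡ colour a
          target-colour : colour target ≡ colour b

        edgeType : Fin (atomicTypes (length Λ))
        edgeType = atomicType source target

      open Edge

      -- Two different commoners may be modelled on the same element; a twin then serves as the
      -- second endpoint.
      edge : ∀ {a} → ¬ King a → ∀ b → Edge a b
      edge {a} ¬king b with em {a ≡ b}
      ... | no a≢b   = record { distinct = a≢b ; source-colour = refl ; target-colour = refl }
      ... | yes refl = let c , a≢c , eq = twin ¬king in
        record { distinct = a≢c ; source-colour = refl ; target-colour = eq }

      -- A type that no edge realises cannot be requested, and an arbitrary edge is the default.
      edgeOfType : ∀ {a} → ¬ King a → ∀ b c → Σ[ ε ∈ Edge a b ] (∀ (ε′ : Edge a b) → edgeType ε′ ≡ c → edgeType ε ≡ c)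
      edgeOfType {a} ¬king b c with em {Σ[ ε ∈ Edge a b ] edgeType ε ≡ c}
      ... | yes (ε , eq) = ε , λ _ _ → eq
      ... | no none      = edge ¬king b , λ ε′ eq → contradiction (ε′ , eq) none

      common-¬King : ∀ u → ¬ King (common u)
      common-¬King u = rep-¬King _

      chosen : ∀ u v → Edge (common u) (common v)
      chosen u v = proj₁ (edgeOfType (common-¬King u) (common v) (wish v))

      -- The tournament makes exactly one of two distinct commoners the upper one, and its reserved
      -- type alone decides the pair, so requests never conflict.
      placeCommon : Commoner → Commoner → A
      placeCommon u v with ⊏-compare u v
      ... | tri< _ _ _ = source (chosen u v)
      ... | tri≈ _ _ _ = common u
      ... | tri> _ _ _ = target (chosen v u)

      placeCommon-source : ∀ {u v} → u ⊏ v → placeCommon u v ≡ source (chosen u v)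
      placeCommon-source {u} {v} u⊏v with ⊏-compare u v
      ... | tri< _ _ _     = refl
      ... | tri≈ ¬u⊏v _ _ = contradiction u⊏v ¬u⊏v
      ... | tri> ¬u⊏v _ _ = contradiction u⊏v ¬u⊏v

      placeCommon-target : ∀ {u v} → u ⊏ v → placeCommon v u ≡ target (chosen u v)
      placeCommon-target {u} {v} u⊏v with ⊏-compare v u
      ... | tri< _ _ ¬u⊏v = contradiction u⊏v ¬u⊏v
      ... | tri≈ _ _ ¬u⊏v = contradiction u⊏v ¬u⊏v
      ... | tri> _ _ _     = refl

      placeCommon-refl : ∀ u → placeCommon u u ≡ common u
      placeCommon-refl u with ⊏-compare u u
      ... | tri< _ u≢u _ = contradiction refl u≢u
      ... | tri≈ _ _ _   = refl
      ... | tri> _ u≢u _ = contradiction refl u≢u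

      placeCommon-equal : ∀ {u v} → placeCommon u v ≡ placeCommon v u → u ≡ v
      placeCommon-equal {u} {v} eq = decide (⊏-compare u v)
        where
        decide : Tri (u ⊏ v) (u ≡ v) (v ⊏ u) → u ≡ v
        decide (tri< u⊏v _ _) = contradiction
          (trans (sym (placeCommon-source u⊏v)) (trans eq (placeCommon-target u⊏v))) (distinct (chosen u v))
        decide (tri≈ _ u≡v _) = u≡v
        decide (tri> _ _ v⊏u) = contradiction
          (trans (sym (placeCommon-source v⊏u)) (trans (sym eq) (placeCommon-target v⊏u))) (distinct (chosen v u))

      placeCommon-colour : ∀ u v → colour (placeCommon u v) ≡ colour (common u)
      placeCommon-colour u v with ⊏-compare u v
      ... | tri< _ _ _ = source-colour (chosen u v)
      ... | tri≈ _ _ _ = refl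
      ... | tri> _ _ _ = target-colour (chosen v u)

      Element : Set
      Element = Fin kings ⊎ Commoner

      original : Element → A
      original (inj₁ i) = king i
      original (inj₂ u) = common u

      -- A pair involving a king is copied unchanged from `𝒜`; only pairs of commoners are
      -- rearranged.
      place : Element → Element → A
      place (inj₁ i) _        = king i
      place (inj₂ u) (inj₁ _) = common u
      place (inj₂ u) (inj₂ v) = placeCommon u v

      place-type : ∀ d e → colour (place d e) ≡ colour (original d)
      place-type (inj₁ i) _        = refl
      place-type (inj₂ u) (inj₁ _) = refl
      place-type (inj₂ u) (inj₂ v) = placeCommon-colour u v

      place-refl : ∀ d → place d d ≡ original d
      place-refl (inj₁ i) = refl
      place-refl (inj₂ u) = placeCommon-refl u

      king≢common : ∀ i u → king i ≢ common u
      king≢common i u eq = common-¬King u (subst King eq (king-King i))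

      place-equal : ∀ {d e} → place d e ≡ place e d → d ≡ e
      place-equal {inj₁ i} {inj₁ j} eq = cong inj₁ (colour-king-injective (cong colour eq))
      place-equal {inj₁ i} {inj₂ v} eq = contradiction eq (king≢common i v)
      place-equal {inj₂ u} {inj₁ j} eq = contradiction (sym eq) (king≢common j u)
      place-equal {inj₂ u} {inj₂ v} eq = cong inj₂ (placeCommon-equal eq)

      place-king : ∀ d i → place d (inj₁ i) ≡ original d
      place-king (inj₁ _) i = refl
      place-king (inj₂ _) i = refl

      commonerFor : ∀ {a} → ¬ King a → Fin (atomicTypes (length Λ)) → Fin 3 → Commoner
      commonerFor {a} ¬king c k = combine (proj₁ (rep-cover a ¬king)) c , k

      commonerFor-refined : ∀ {a} (¬king : ¬ King a) c k → refined (common (commonerFor ¬king c k)) ≡ refined a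
      commonerFor-refined {a} ¬king c k =
        trans (cong (refined ∘ rep ∘ proj₁) (remQuot-combine (proj₁ (rep-cover a ¬king)) c)) (proj₂ (rep-cover a ¬king))

      commonerFor-wish : ∀ {a} (¬king : ¬ King a) c k → wish (commonerFor ¬king c k) ≡ c
      commonerFor-wish {a} ¬king c k = cong proj₂ (remQuot-combine (proj₁ (rep-cover a ¬king)) c)

      Witness : Element → A → Set
      Witness d a = ∃[ e ] atomicType (original d) a ≡ atomicType (place d e) (place e d) × colour a ≡ colour (original e)

      witness : ∀ d a → Witness d a
      witness d a = find d a em em
        where
        find : ∀ d a → Dec (original d ≡ a) → Dec (King a) → Witness d a
        -- An element may witness its own diagonal request.
        find d a (yes refl) _ = d , cong₂ atomicType (sym (place-refl d)) (sym (place-refl d)) , refl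
        find d a (no _) (yes kinga) with king-surjective a kinga
        ... | i , refl = inj₁ i , cong (λ z → atomicType z (king i)) (sym (place-king d i)) , refl
        -- The class of `a` remembers the type with every king, so the reserved type and the layer
        -- are arbitrary here.
        find (inj₁ i) a (no _) (no ¬king) =
          let u  = commonerFor ¬king (atomicType a a) zero
              eq = sym (commonerFor-refined ¬king (atomicType a a) zero)
          in inj₂ u , refined-atomic {a} {common u} eq i , refined-colour {a} {common u} eq
        find (inj₂ v) a (no v≢a) (no ¬king) =
          inj₂ u , sym (trans (cong₂ atomicType (placeCommon-source v⊏u) (placeCommon-target v⊏u)) fulfilled) , a≡u
          where
          c : Fin (atomicTypes (length Λ))
          c = atomicType (common v) a
          u : Commoner
          -- The next layer puts `u` above `v`, so that the type reserved for `u` governs the pair.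
          u = commonerFor ¬king c (above (proj₂ v))
          v⊏u : v ⊏ u
          v⊏u = ⊏-above v
          a≡u : colour a ≡ colour (common u)
          a≡u = refined-colour {a} {common u} (sym (commonerFor-refined ¬king c (above (proj₂ v))))
          fulfilled : edgeType (chosen v u) ≡ c
          -- The requested pair is itself an edge of type `c`, so the chosen edge has this type too.
          fulfilled = trans
            (proj₂ (edgeOfType (common-¬King v) (common u) (wish u))
              (record { source = common v ; target = a ; distinct = v≢a ; source-colour = refl ; target-colour = a≡u })
              (sym (commonerFor-wish ¬king c (above (proj₂ v)))))
            (commonerFor-wish ¬king c (above (proj₂ v)))

      someElement : Element
      someElement with em {King (point 𝒜)}
      ... | yes kingp = inj₁ (proj₁ (king-surjective (point 𝒜) kingp))
      ... | no ¬king  = inj₂ (commonerFor ¬king (atomicType (point 𝒜) (point 𝒜)) zero)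

      blueprint : Blueprint K
      blueprint = record
        { B           = Element
        ; origin      = someElement
        ; original    = original
        ; place       = place
        ; place-type  = place-type
        ; place-equal = place-equal
        ; witness     = witness
        }

      order : ℕ
      order = kings + classes * atomicTypes (length Λ) * 3

      Element↔Fin : Element ↔ Fin order
      Element↔Fin = ↔-sym ((↔-id _ ⊎-↔ *↔×) ↔-∘ +↔⊎)

-- Size bounds by towers of exponentials.

tower : ℕ → ℕ
tower h = exp h 1

n<2^n : ∀ n → suc n ≤ 2 ^ n
n<2^n zero    = s≤s z≤n
n<2^n (suc n) = +-mono-≤ (m^n>0 2 n) (≤-trans (n<2^n n) (m≤m+n (2 ^ n) 0))

n≤2^n : ∀ n → n ≤ 2 ^ n
n≤2^n n = ≤-trans (n≤1+n n) (n<2^n n)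

n≤tower : ∀ n → n ≤ tower n
n≤tower zero    = z≤n
n≤tower (suc n) = ≤-trans (s≤s (n≤tower n)) (n<2^n (tower n))

tower-≤-+ : ∀ k h → tower h ≤ tower (k + h)
tower-≤-+ zero    h = ≤-refl
tower-≤-+ (suc k) h = ≤-trans (tower-≤-+ k h) (n≤2^n (tower (k + h)))

1≤tower : ∀ h → 1 ≤ tower h
1≤tower zero    = ≤-refl
1≤tower (suc h) = m^n>0 2 (tower h)

2^-tower : ∀ h {a} → a ≤ tower h → 2 ^ a ≤ tower (1 + h)
2^-tower h = ^-monoʳ-≤ 2

n+n≤2^n : ∀ {n} → 1 ≤ n → n + n ≤ 2 ^ n
n+n≤2^n {suc n} _ = ≤-trans (+-mono-≤ (n<2^n n) (n<2^n n)) (≤-reflexive (cong (2 ^ n +_) (sym (+-identityʳ (2 ^ n)))))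

-- Each operation adds a fixed height: sums 1, products 2, powers 3.
+-tower : ∀ h {a b} → a ≤ tower h → b ≤ tower h → a + b ≤ tower (1 + h)
+-tower h p q = ≤-trans (+-mono-≤ p q) (n+n≤2^n (1≤tower h))

*-tower : ∀ h {a b} → a ≤ tower h → b ≤ tower h → a * b ≤ tower (2 + h)
*-tower h {a} {b} p q = begin
  a * b             ≤⟨ *-mono-≤ (n≤2^n a) (n≤2^n b) ⟩
  2 ^ a * 2 ^ b     ≡⟨ sym (^-distribˡ-+-* 2 a b) ⟩
  2 ^ (a + b)       ≤⟨ 2^-tower (1 + h) (+-tower h p q) ⟩
  tower (2 + h)     ∎
  where open ≤-Reasoning

^-tower : ∀ h {a b} → a ≤ tower h → b ≤ tower h → a ^ b ≤ tower (3 + h)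
^-tower h {a} {b} p q = begin
  a ^ b             ≤⟨ ^-monoˡ-≤ b (n≤2^n a) ⟩
  (2 ^ a) ^ b       ≡⟨ ^-*-assoc 2 a b ⟩
  2 ^ (a * b)       ≤⟨ 2^-tower (2 + h) (*-tower h p q) ⟩
  tower (3 + h)     ∎
  where open ≤-Reasoning

-- The hypothesis puts `n` below height 1 + l; successor, exponential and product add 1, 1 and 2.
atomicTypes-tower : ∀ {n} l → n ≤ 2 ^ l → atomicTypes n ≤ tower (5 + l)
atomicTypes-tower {n} l n≤ = *-tower (3 + l) 2^1+n≤ 2^1+n≤
  where
  2^1+n≤ : 2 ^ suc n ≤ tower (3 + l)
  2^1+n≤ = 2^-tower (2 + l) (+-tower (1 + l) (1≤tower (1 + l)) (≤-trans n≤ (2^-tower l (n≤tower l))))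

-- Each rank costs height 3: a product and an exponential.
elementTypes-tower : ∀ {n} l → n ≤ 2 ^ l → ∀ j → elementTypes n j ≤ tower (j * 3 + (5 + l))
elementTypes-tower l n≤ zero    = atomicTypes-tower l n≤
elementTypes-tower l n≤ (suc j) = 2^-tower (2 + (j * 3 + (5 + l))) (*-tower (j * 3 + (5 + l))
  (≤-trans (atomicTypes-tower l n≤) (tower-≤-+ (j * 3) (5 + l))) (elementTypes-tower l n≤ j))

-- At rank l + 1 the types are bounded by height `H`, which is 4l + 8. A power, three products and a
-- sum add 10, and 4l + 18 is at most 22l because l is positive.
order-tower : ∀ {n} l {kings classes} → n ≤ 2 ^ l → 1 ≤ l →
  kings ≤ elementTypes n (suc l) → classes ≤ elementTypes n (suc l) * atomicTypes n ^ kings →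
  kings + classes * atomicTypes n * 3 ≤ tower (22 * l)
order-tower {n} (suc m) {kings} {classes} n≤ _ kings≤ classes≤ =
  ≤-trans order≤ (≤-trans (tower-≤-+ (18 * m) (10 + H)) (≤-reflexive (cong tower (height m))))
  where
  H : ℕ
  H = suc (suc m) * 3 + (5 + suc m)
  height : ∀ m → 18 * m + (10 + (suc (suc m) * 3 + (5 + suc m))) ≡ 22 * suc m
  height = solve-∀
  raise : ∀ k {a} → a ≤ tower H → a ≤ tower (k + H)
  raise k p = ≤-trans p (tower-≤-+ k H)
  L≤ : elementTypes n (suc (suc m)) ≤ tower H
  L≤ = elementTypes-tower (suc m) n≤ (suc (suc m))
  r≤ : atomicTypes n ≤ tower H
  r≤ = ≤-trans (atomicTypes-tower (suc m) n≤) (tower-≤-+ (suc (suc m) * 3) (5 + suc m))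
  3≤ : 3 ≤ tower (7 + H)
  3≤ = ≤-trans (n≤tower 3) (≤-trans (tower-≤-+ (4 + H) 3) (≤-reflexive (cong tower (shift H))))
    where
    shift : ∀ h → 4 + h + 3 ≡ 7 + h
    shift = solve-∀
  classes≤′ : classes ≤ tower (5 + H)
  classes≤′ = ≤-trans classes≤ (*-tower (3 + H) (raise 3 L≤) (^-tower H r≤ (≤-trans kings≤ L≤)))
  order≤ : kings + classes * atomicTypes n * 3 ≤ tower (10 + H)
  order≤ = +-tower (9 + H) (raise 9 (≤-trans kings≤ L≤))
    (*-tower (7 + H) (*-tower (5 + H) classes≤′ (raise 5 r≤)) 3≤)

-- Assembling the small model and its team.

finiteModel : (∀ {P : Set} → Dec P) → {τ : Vocabulary} → Relational τ → (φ : FO∼ τ) → ∀ {x y} → x ≢ y →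
  vars φ ⊆ˡ x ∷ y ∷ [] → IsSatisfiable φ →
  Σ[ 𝓑 ∈ Structure τ ] SizeAtMost (exp (22 * ∣ φ ∣) 1) 𝓑 × SatisfiableIn 𝓑 φ
finiteModel em {τ} relational φ {x} {y} x≢y xy (𝒜 , X , 𝒯 , h , ⊨φ) =
  model ,
  (order , order-tower ∣ φ ∣ (length-atoms φ) 1≤∣ φ ∣ kings≤ classes≤ , Element↔Fin) ,
  X , 𝒯′ , h , sat-preserved x y x≢y relational backForth φ ≤-refl xy id match h h ⊨φ
  where
  open Classical em
  open Types relational 𝒜 (atoms φ)
  -- The extra rank pays for one move before the game: the start is a diagonal position, from which
  -- the second pebble moves to the value of `y`.
  open Construction (suc ∣ φ ∣)
  open Realise blueprint

  -- All assignments with a partner in `𝒯` are taken, which makes the back condition true by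
  -- definition.
  𝒯′ : Team X (dom model)
  𝒯′ .member s′ = ∃[ s ] s ∈ member 𝒯 × Match x y x≢y relational backForth ∣ φ ∣ s s′
  𝒯′ .member-resp s′≗t′ (s , s∈ , m) =
    s , s∈ , match-resp x y x≢y relational backForth (λ _ _ → refl) s′≗t′ m

  value : (s : Assignment X (dom 𝒜)) (v : Var) → ∃[ a ] (.(v∈X : v ∈ X) → s v v∈X ≡ a)
  value s v with em {v ∈ X}
  ... | yes v∈X = s v v∈X , λ _ → refl
  -- Outside `X` any default serves, since there is nothing to read.
  ... | no  v∉X = point 𝒜 , λ v∈X → ⊥-elim-irr (v∉X v∈X)

  match : TeamMatch x y x≢y relational backForth ∣ φ ∣ 𝒯 𝒯′
  match = forth , λ s′ s′∈ → s′∈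
    where
    forth : ∀ s → s ∈ member 𝒯 → ∃[ s′ ] s′ ∈ member 𝒯′ × Match x y x≢y relational backForth ∣ φ ∣ s s′
    forth s s∈ =
      let a , s-x = value s x
          b , s-y = value s y
          d , start = related-start a
          e , z = related-forth start b
          s′ : Assignment X (dom model)
          s′ = λ v _ → pick d e (does (v ≟ x))
          m : Match x y x≢y relational backForth ∣ φ ∣ s s′
          m = matching (s-x , s-y)
                ((λ _ → cong (pick d e) (dec-true (x ≟ x) refl)) ,
                 (λ _ → cong (pick d e) (dec-false (y ≟ x) (x≢y ∘ sym)))) z
      in s′ , (s , s∈ , m) , m

theorem4p3 : ExcludedMiddle (lsuc 0ℓ) →
    (τ : Vocabulary) → Relational τ →
    ∃[ c ] ((φ : FO∼ τ) → TwoVariable φ → IsSatisfiable φ →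
    Σ[ 𝓑 ∈ Structure τ ] SizeAtMost (exp (c * ∣ φ ∣) 1) 𝓑 × SatisfiableIn 𝓑 φ)
theorem4p3 em τ relational = 22 , bounded
  where
  em₀ : ∀ {P : Set} → Dec P
  em₀ = map′ lower lift em
  bounded : (φ : FO∼ τ) → TwoVariable φ → IsSatisfiable φ →
    Σ[ 𝓑 ∈ Structure τ ] SizeAtMost (exp (22 * ∣ φ ∣) 1) 𝓑 × SatisfiableIn 𝓑 φ
  bounded φ (x , y , xy) with x ≟ y
  ... | no  x≢y  = finiteModel em₀ relational φ x≢y xy
  -- If both names coincide, `suc x` is supplied as a second, distinct variable.
  ... | yes refl = finiteModel em₀ relational φ {x} {suc x} m≢1+m λ v∈ → widen (xy v∈)
    where
    m≢1+m : ∀ {m} → m ≢ suc m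
    m≢1+m ()
    widen : ∀ {v} → v ∈ˡ x ∷ x ∷ [] → v ∈ˡ x ∷ suc x ∷ []
    widen (here eq)         = here eq
    widen (there (here eq)) = here eq
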